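{- Let $k\ge 3$ and $n\ge 2$ be integers and let $d(k)=(2k+1)^{8k+4}k^2(k+1)$. Let $G$ be a graph and let $(H,\sigma)$ be a $k$-system of magnitude at least $d(k)n$ in $G$. Then $G$ contains $S_{n,k}$ as a strong immersion respecting $(H,\sigma)$; that is, there is a strong immersion $\theta$ of $S_{n,k}$ in $G$ with $\theta(c(S_{n,k}))=\sigma(c(H))$ and $\theta(R(S_{n,k}))\subseteq\sigma(R(H))$.
   Context: Graphs are finite and may have parallel edges and loops; each loop contributes $2$ to the degree of its vertex. Immersions. An immersion of a graph $H$ in a graph $G$ is a function $\theta$ on the vertices and edges of $H$ such that: (a) $\theta(v)$ is a vertex of $G$ for each $v\in V(H)$, and $\theta$ restricted to $V(H)$ is injective; (b) $\theta(e)$ is a connected subgraph of $G$ for each $e\in E(H)$, and for distinct $e,f\in E(H)$ the subgraphs $\theta(e)$ and $\theta(f)$ are edge-disjoint; (c) if $e\in E(H)$ is incident with $v\in V(H)$, then $\theta(v)$ is a vertex of $\theta(e)$, and if $e$ is a loop, then $\theta(e)$ contains a cycle passing through $\theta(v)$. The immersion is strong if, in addition, whenever $e\in E(H)$ is not incident with $v\in V(H)$, $\theta(e)$ does not contain $\theta(v)$. Multistars. A multistar is a connected loopless graph $H$ with at least three vertices that contains a vertex incident with all its edges; this vertex is the center $c(H)$, and all other vertices are rays, forming the set $R(H)$. $S_{n,k}$ denotes the multistar with $n$ rays, each of degree $k$. $k$-systems. A $k$-system of magnitude $d$ in a graph $G$ is a pair $(H,\sigma)$, where $H$ is a multistar and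 $\sigma$ is a strong immersion of $H$ in $G$, such that: $H$ has at least $d$ edges; every ray of $H$ has degree at most $k$ in $H$; and for each $v\in R(H)$ there is no edge cut in $G$ of size less than $k$ separating $\sigma(c(H))$ from $\sigma(v)$. -}

module Defs where

open import Data.Bool.Base using (true; false; _xor_)
open import Data.Fin.Base
  using (Fin; zero; suc; inject₁; fromℕ; fromℕ<; quotient; combine; _↑ˡ_; _↑ʳ_)
open import Data.Fin.Properties using (_≟_; remQuot-combine; splitAt-↑ˡ; splitAt-↑ʳ)
open import Data.Fin.Subset using (Subset; _∈_; _∉_; ⊤; ∣_∣)
open import Data.Fin.Subset.Properties using (∈⊤)
open import Data.Nat.Base using (ℕ; zero; suc; _+_; _*_; _^_; _≤_; _<_; s≤s)
open import Data.Product.Base using (Σ; ∃-syntax; _×_; _,_; proj₁; proj₂)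
open import Data.Sum.Base using (_⊎_; inj₁; inj₂)
open import Data.Vec.Base using (tabulate; lookup)
open import Data.Vec.Properties using (tabulate-cong)
open import Function.Definitions using (Injective)
open import Relation.Binary.Construct.Closure.ReflexiveTransitive using (Star; ε; _◅_)
open import Relation.Binary.PropositionalEquality
open import Relation.Nullary using (¬_; does)

-- Finite graphs with parallel edges and loops.  The order of the two ends of
-- an edge is an artefact of the encoding: no notion below depends on it.
record Graph : Set where
  field
    #V #E : ℕ
    ends  : Fin #E → Fin #V × Fin #V

  Vertex Edge : Set
  Vertex = Fin #V
  Edge   = Fin #E

  source target : Edge → Vertex
  source e = proj₁ (ends e)
  target e = proj₂ (ends e)

  Joins : Edge → Vertex → Vertex → Set
  Joins e u v = (source e ≡ u × target e ≡ v) ⊎ (source e ≡ v × target e ≡ u)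

  Incident : Edge → Vertex → Set
  Incident e v = source e ≡ v ⊎ target e ≡ v

  IsLoop : Edge → Set
  IsLoop e = source e ≡ target e

  -- A loop at v occurs in both summands, so it contributes 2.
  degree : Vertex → ℕ
  degree v = ∣ tabulate (λ e → does (source e ≟ v)) ∣
           + ∣ tabulate (λ e → does (target e ≟ v)) ∣

  -- The edge cut δ(X): all edges with exactly one end in X.
  δ : Subset #V → Subset #E
  δ X = tabulate (λ e → lookup X (source e) xor lookup X (target e))

  EdgeCutOfSizeBelow : ℕ → Vertex → Vertex → Set
  EdgeCutOfSizeBelow k u v = ∃[ X ] u ∈ X × v ∉ X × ∣ δ X ∣ < k

open Graph

record Subgraph (G : Graph) : Set where
  field
    verts  : Subset (#V G)
    edges  : Subset (#E G)
    closed : ∀ {e} → e ∈ edges → source G e ∈ verts × target G e ∈ verts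

open Subgraph

whole : (G : Graph) → Subgraph G
whole G = record { verts = ⊤ ; edges = ⊤ ; closed = λ _ → ∈⊤ , ∈⊤ }

module _ {G : Graph} where

  Adjacent : Subgraph G → Vertex G → Vertex G → Set
  Adjacent K u v = ∃[ e ] e ∈ edges K × Joins G e u v

  -- A subgraph used below always has a vertex, so the convention for the null
  -- graph is immaterial.
  Connected : Subgraph G → Set
  Connected K = ∀ {u v} → u ∈ verts K → v ∈ verts K → Star (Adjacent K) u v

  EdgeDisjoint : Subgraph G → Subgraph G → Set
  EdgeDisjoint K L = ∀ {e} → e ∈ edges K → e ∉ edges L

  -- A cycle with suc m vertices and suc m edges; m = 0 is a loop and m = 1 a
  -- pair of parallel edges.
  record Cycle (K : Subgraph G) : Set where
    field
      m          : ℕ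
      vertex     : Fin (suc m) → Vertex G
      edge       : Fin (suc m) → Edge G
      vertex-inj : Injective _≡_ _≡_ vertex
      edge-inj   : Injective _≡_ _≡_ edge
      edge∈      : ∀ i → edge i ∈ edges K
      step       : ∀ (i : Fin m) → Joins G (edge (inject₁ i)) (vertex (inject₁ i)) (vertex (suc i))
      close      : Joins G (edge (fromℕ m)) (vertex (fromℕ m)) (vertex zero)

  CycleThrough : Subgraph G → Vertex G → Set
  CycleThrough K v = Σ (Cycle K) λ C → ∃[ i ] Cycle.vertex C i ≡ v

record Immersion (H G : Graph) : Set where
  field
    onV       : Vertex H → Vertex G
    onE       : Edge H → Subgraph G
    injective : Injective _≡_ _≡_ onV
    connected : ∀ e → Connected (onE e)
    disjoint  : ∀ {e f} → e ≢ f → EdgeDisjoint (onE e) (onE f)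
    incident  : ∀ {e v} → Incident H e v → onV v ∈ verts (onE e)
    loop      : ∀ {e v} → Incident H e v → IsLoop H e → CycleThrough (onE e) (onV v)

record StrongImmersion (H G : Graph) : Set where
  field
    immersion : Immersion H G

  open Immersion immersion public

  field
    strong : ∀ {e v} → ¬ Incident H e v → onV v ∉ verts (onE e)

-- With at least three vertices and connectedness the center is determined by
-- the graph, so storing it is no extra choice.
record Multistar : Set where
  field
    graph      : Graph
    center     : Vertex graph
    connected  : Connected (whole graph)
    loopless   : ∀ e → ¬ IsLoop graph e
    ≥3-verts   : 3 ≤ #V graph
    all-center : ∀ e → Incident graph e center

  IsRay : Vertex graph → Set
  IsRay v = v ≢ center

-- The k edges at ray suc i are those numbered i * k, …, i * k + (k - 1).
starGraph : ℕ → ℕ → Graph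
starGraph n k = record
  { #V   = suc n
  ; #E   = n * k
  ; ends = λ e → zero , suc (quotient k e)
  }

S : (n k : ℕ) → 2 ≤ n → 1 ≤ k → Multistar
S n k 2≤n 1≤k = record
  { graph      = G
  ; center     = zero
  ; connected  = λ {u} {v} _ _ → conn u v
  ; loopless   = λ _ ()
  ; ≥3-verts   = s≤s 2≤n
  ; all-center = λ _ → inj₁ refl
  }
  where
  G : Graph
  G = starGraph n k

  spoke : Fin n → Edge G
  spoke i = combine i (fromℕ< 1≤k)

  spoke-ray : ∀ i → quotient k (spoke i) ≡ i
  spoke-ray i = cong proj₁ (remQuot-combine {n} {k} i (fromℕ< 1≤k))

  from-center : ∀ v → Star (Adjacent (whole G)) zero v
  from-center zero    = ε
  from-center (suc j) = (spoke j , ∈⊤ , inj₁ (refl , cong suc (spoke-ray j))) ◅ ε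

  conn : ∀ u v → Star (Adjacent (whole G)) u v
  conn zero    v = from-center v
  conn (suc i) v = (spoke i , ∈⊤ , inj₂ (refl , cong suc (spoke-ray i))) ◅ from-center v

S-ray-degree : ∀ n k (i : Fin n) → degree (starGraph n k) (suc i) ≡ k
S-ray-degree n k i = cong₂ _+_ (const-false (n * k)) (hits n i)
  where
  const-false : ∀ m → ∣ tabulate {n = m} (λ _ → false) ∣ ≡ 0
  const-false zero    = refl
  const-false (suc m) = const-false m

  const-true : ∀ m → ∣ tabulate {n = m} (λ _ → true) ∣ ≡ m
  const-true zero    = refl
  const-true (suc m) = cong suc (const-true m)

  split : ∀ a b (f : Fin (a + b) → _) →
          ∣ tabulate f ∣ ≡ ∣ tabulate (λ x → f (x ↑ˡ b)) ∣ + ∣ tabulate (λ x → f (a ↑ʳ x)) ∣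
  split zero    b f = refl
  split (suc a) b f with f zero
  ... | true  = cong suc (split a b (λ x → f (suc x)))
  ... | false = split a b (λ x → f (suc x))

  hit : ∀ {m} → Fin m → Fin (m * k) → _
  hit {m} j e = does (suc (quotient {m} k e) ≟ suc j)

  low : ∀ m (x : Fin k) → quotient {suc m} k (x ↑ˡ (m * k)) ≡ zero
  low m x rewrite splitAt-↑ˡ k x (m * k) = refl

  high : ∀ m (x : Fin (m * k)) → quotient {suc m} k (k ↑ʳ x) ≡ suc (quotient {m} k x)
  high m x rewrite splitAt-↑ʳ k (m * k) x = refl

  +0 : ∀ m → m + 0 ≡ m
  +0 zero    = refl
  +0 (suc m) = cong suc (+0 m)

  card-cong : ∀ {m} {f g : Fin m → _} → (∀ x → f x ≡ g x) → ∣ tabulate f ∣ ≡ ∣ tabulate g ∣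
  card-cong eq = cong ∣_∣ (tabulate-cong eq)

  hits : ∀ m (j : Fin m) → ∣ tabulate (hit j) ∣ ≡ k
  hits (suc m) zero = trans (split k (m * k) (hit {suc m} zero)) (trans (cong₂ _+_
    (trans (card-cong (λ x → cong (λ q → does (suc q ≟ suc zero)) (low m x))) (const-true k))
    (trans (card-cong (λ x → cong (λ q → does (suc q ≟ suc zero)) (high m x))) (const-false (m * k))))
    (+0 k))
  hits (suc m) (suc j) = trans (split k (m * k) (hit {suc m} (suc j))) (cong₂ _+_
    (trans (card-cong (λ x → cong (λ q → does (suc q ≟ suc (suc j))) (low m x))) (const-false k))
    (trans (card-cong (λ x → cong (λ q → does (suc q ≟ suc (suc j))) (high m x))) (hits m j)))

record KSystem (k d : ℕ) (G : Graph) : Set where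
  field
    H : Multistar

  open Multistar H public

  field
    σ           : StrongImmersion graph G
    magnitude   : d ≤ #E graph
    ray-degree  : ∀ v → IsRay v → degree graph v ≤ k
    no-edge-cut : ∀ v → IsRay v →
      ¬ EdgeCutOfSizeBelow G k (StrongImmersion.onV σ center) (StrongImmersion.onV σ v)

record Respects {k d G} (M : Multistar) (θ : StrongImmersion (Multistar.graph M) G)
                (sys : KSystem k d G) : Set where
  open KSystem sys using (H; σ)
  module M = Multistar M
  module H = Multistar H
  module θ = StrongImmersion θ
  module σ = StrongImmersion σ

  field
    center↦center : θ.onV M.center ≡ σ.onV H.center
    rays⊆rays     : ∀ r → M.IsRay r → ∃[ s ] H.IsRay s × θ.onV r ≡ σ.onV s

d : ℕ → ℕ
d k = (2 * k + 1) ^ (8 * k + 4) * k ^ 2 * (k + 1)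

{-# OPTIONS --safe #-}
module Submission where

open import Data.Bool.Base using (Bool; true; false; not; _∧_; _∨_; _xor_; if_then_else_)
import Data.Bool.Properties as Bool
open import Data.Fin.Base using (Fin; zero; suc; quotient; remainder; combine)
open import Data.Fin.Properties using (_≟_; any?; suc-injective; combine-remQuot)
import Data.Fin.Subset as Subset
open import Data.Fin.Subset.Properties using (anySubset?; ∈⊤) renaming (_∈?_ to _∈ˢ?_)
open import Data.Nat.Base
  using (ℕ; zero; suc; _+_; _*_; _^_; _∸_; _≤_; _<_; z≤n; s≤s; s≤s⁻¹; z<s; NonZero; >-nonZero)
import Data.Nat.Properties as Nat
open import Data.Nat.Properties
  using ( ≤-trans; ≤-refl; ≤-reflexive; <-irrefl; <-≤-trans; <⇒≤; ≰⇒>; ≮⇒≥; _≤?_; _<?_; n≤1+n; m≤m+n; m≤n+m; m∸n≤m; m≤m*n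
        ; +-comm; +-identityʳ; +-suc; +-mono-≤; +-monoˡ-≤; +-monoʳ-≤; +-cancelˡ-≤; +-cancelʳ-≤
        ; *-comm; *-assoc; *-suc; *-identityʳ; *-mono-≤; *-monoˡ-≤; *-monoʳ-≤; *-cancelˡ-≤; m*n≢0
        ; ^-monoˡ-≤; ^-monoʳ-≤; m^n≢0; module ≤-Reasoning)
open import Data.Product.Base using (Σ-syntax; ∃; _×_; _,_; proj₁; proj₂)
open import Data.Sum.Base using (_⊎_; inj₁; inj₂; [_,_]′)
open import Data.Vec.Base using (tabulate; lookup)
open import Data.Vec.Functional using (updateAt)
open import Data.Vec.Functional.Properties using (updateAt-updates; updateAt-minimal)
open import Data.Vec.Properties using (lookup∘tabulate; lookup⇒[]=; []=⇒lookup)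
open import Defs
open import Function.Base using (_∘_; id)
open import Function.Definitions using (Injective)
open import Relation.Binary.Construct.Closure.ReflexiveTransitive using (Star; ε; _◅_; _◅◅_; reverse)
open import Relation.Binary.PropositionalEquality
open import Relation.Nullary using (¬_; Dec; yes; no; does; contradiction)
open import Relation.Nullary.Decidable using (dec-true; dec-false; map′; from-yes; _×-dec_; ¬?)
open import Algebra.Properties.Semiring.Sum Nat.+-*-semiring
  using (sum; sum-cong-≗; sum-replicate-zero; ∑-distrib-+; ∑-comm; *-distribˡ-sum)

-- Every edge is assigned to at most one terminal, so that the set Z_v of edges of a terminal v contains j edges of every
-- cut between v and the centre c, and touches no other terminal.  For j = 1 the edges of the paths σ(e) of the k-system
-- do this, and if j < k one can pass to j + 1 and keep one sixth of the terminals: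
--
-- Let Y_v be the least set with v inside and c outside which Z_v leaves by j edges only.  At least j + 1 edges of G leave
-- Y_v; give such an edge to v if it is unassigned.  When this is no longer possible, Y_v meets Z_h for another
-- terminal h (or an edge joins v to h).  Select a third of the terminals so that none of them is the h of another one.
-- The unselected Z_h connect a point of each Y_v to c, and a T-join argument turns them into edge-disjoint connections
-- that lead each of these points to c or to the point of another selected terminal l.  In the first case the connection
-- raises all cuts of Z_v from j to j + 1; in the second case l is given up and Z_l continues the connection to c.
--
-- For j = k Menger's theorem inside each Z_v gives the k paths.

-- Boolean sets on finite types and their cardinalities

private variable
  n : ℕ

BSet : ℕ → Set
BSet n = Fin n → Bool

infix 4 _∈_ _∉_ _⊆_
_∈_ _∉_ : Fin n → BSet n → Set
x ∈ A = A x ≡ true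
x ∉ A = A x ≡ false

_⊆_ : BSet n → BSet n → Set
A ⊆ B = ∀ {x} → x ∈ A → x ∈ B

∈∉ : ∀ {ℓ} {P : Set ℓ} {b : Bool} → b ≡ true → b ≡ false → P
∈∉ refl ()

∈? : (A : BSet n) (x : Fin n) → x ∈ A ⊎ x ∉ A
∈? A x with A x
... | true  = inj₁ refl
... | false = inj₂ refl

∧-intro : ∀ {a b} → a ≡ true → b ≡ true → a ∧ b ≡ true
∧-intro refl refl = refl

∧-elim : ∀ {a b} → a ∧ b ≡ true → a ≡ true × b ≡ true
∧-elim {true} {true} refl = refl , refl

∧-falseˡ : ∀ {a} b → a ≡ false → a ∧ b ≡ false
∧-falseˡ b refl = refl

∧-falseʳ : ∀ a {b} → b ≡ false → a ∧ b ≡ false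
∧-falseʳ true  refl = refl
∧-falseʳ false refl = refl

∧-false : ∀ {a b} → a ∧ b ≡ false → a ≡ false ⊎ b ≡ false
∧-false {true}  p = inj₂ p
∧-false {false} p = inj₁ refl

∨-introˡ : ∀ {a b} → a ≡ true → a ∨ b ≡ true
∨-introˡ refl = refl

∨-introʳ : ∀ a {b} → b ≡ true → a ∨ b ≡ true
∨-introʳ true  refl = refl
∨-introʳ false refl = refl

∨-elim : ∀ {a b} → a ∨ b ≡ true → a ≡ true ⊎ b ≡ true
∨-elim {true}  p = inj₁ refl
∨-elim {false} p = inj₂ p

∨-false : ∀ {a b} → a ≡ false → b ≡ false → a ∨ b ≡ false
∨-false refl refl = refl

not-true : ∀ {a} → not a ≡ true → a ≡ false
not-true {false} p = refl

not-intro : ∀ {a} → a ≡ false → not a ≡ true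
not-intro refl = refl

-- Abstract, so that goals keep the form `is x y` instead of an unfolded decision; the four lemmas
-- of the block are the whole interface.
abstract
  is : Fin n → Fin n → Bool
  is x y = does (x ≟ y)

  is-true : {x y : Fin n} → is x y ≡ true → x ≡ y
  is-true {x = x} {y} p with x ≟ y
  ... | yes eq = eq

  is-≡ : {x y : Fin n} → x ≡ y → is x y ≡ true
  is-≡ {x = x} {y} eq = dec-true (x ≟ y) eq

  is-≢ : {x y : Fin n} → x ≢ y → is x y ≡ false
  is-≢ {x = x} {y} neq = dec-false (x ≟ y) neq

  is-suc : (x y : Fin n) → is (suc x) (suc y) ≡ is x y
  is-suc x y = refl

is-refl : (x : Fin n) → is x x ≡ true
is-refl x = is-≡ refl

is-false : {x y : Fin n} → is x y ≡ false → x ≢ y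
is-false {x = x} p refl = ∈∉ (is-refl x) p

∅ : BSet n
∅ _ = false

infixl 7 _∩_ _∖_
infixl 6 _∪_
_∩_ _∪_ : BSet n → BSet n → BSet n
(A ∩ B) x = A x ∧ B x
(A ∪ B) x = A x ∨ B x

∁ : BSet n → BSet n
∁ A x = not (A x)

⁅_⁆ : Fin n → BSet n
⁅ a ⁆ x = is a x

_∖_ : BSet n → Fin n → BSet n
(A ∖ a) x = A x ∧ not (is a x)

∖-∈ : (A : BSet n) {a x : Fin n} → x ∈ A → a ≢ x → x ∈ A ∖ a
∖-∈ A p q = ∧-intro p (not-intro (is-≢ q))

∖-∉ : (A : BSet n) (a : Fin n) → a ∉ A ∖ a
∖-∉ A a = ∧-falseʳ (A a) (cong not (is-refl a))

∖-⊆ : (A : BSet n) {a x : Fin n} → x ∈ A ∖ a → x ∈ A × a ≢ x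
∖-⊆ A p = proj₁ (∧-elim p) , is-false (not-true (proj₂ (∧-elim p)))

⟦_⟧ : Bool → ℕ
⟦ true ⟧  = 1
⟦ false ⟧ = 0

cnt : BSet n → ℕ
cnt A = sum (λ x → ⟦ A x ⟧)

sum-mono : {f g : Fin n → ℕ} → (∀ x → f x ≤ g x) → sum f ≤ sum g
sum-mono {zero}  p = z≤n
sum-mono {suc n} p = +-mono-≤ (p zero) (sum-mono (p ∘ suc))

⟦⟧-mono : ∀ {a b} → (a ≡ true → b ≡ true) → ⟦ a ⟧ ≤ ⟦ b ⟧
⟦⟧-mono {true}  {b}    p rewrite p refl = ≤-refl
⟦⟧-mono {false} {_}    p = z≤n

cnt-mono : (A B : BSet n) → A ⊆ B → cnt A ≤ cnt B
cnt-mono A B p = sum-mono {f = ⟦_⟧ ∘ A} {⟦_⟧ ∘ B} (λ _ → ⟦⟧-mono p)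

cnt-cong : (A B : BSet n) → A ≗ B → cnt A ≡ cnt B
cnt-cong A B p = sum-cong-≗ (λ x → cong ⟦_⟧ (p x))

-- Submodularity of cuts and modularity of token counts both come from this: the inequality only has
-- to be checked at each point, where it is a statement about Booleans.
cnt-≤₂ : (A B C D : BSet n) → (∀ x → ⟦ A x ⟧ + ⟦ B x ⟧ ≤ ⟦ C x ⟧ + ⟦ D x ⟧) →
         cnt A + cnt B ≤ cnt C + cnt D
cnt-≤₂ A B C D p = begin
  cnt A + cnt B                  ≡⟨ sym (∑-distrib-+ (⟦_⟧ ∘ A) (⟦_⟧ ∘ B)) ⟩
  sum (λ x → ⟦ A x ⟧ + ⟦ B x ⟧)  ≤⟨ sum-mono p ⟩
  sum (λ x → ⟦ C x ⟧ + ⟦ D x ⟧)  ≡⟨ ∑-distrib-+ (⟦_⟧ ∘ C) (⟦_⟧ ∘ D) ⟩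
  cnt C + cnt D                  ∎
  where open ≤-Reasoning

cnt-∅ : cnt {n} ∅ ≡ 0
cnt-∅ {n} = sum-replicate-zero n

cnt-full : cnt {n} (λ _ → true) ≡ n
cnt-full {zero}  = refl
cnt-full {suc n} = cong suc (cnt-full {n})

cnt≤ : (A : BSet n) → cnt A ≤ n
cnt≤ {n} A = ≤-trans (cnt-mono A (λ _ → true) (λ _ → refl)) (≤-reflexive (cnt-full {n}))

cnt-⁅⁆ : (a : Fin n) → cnt ⁅ a ⁆ ≡ 1
cnt-⁅⁆ {suc n} zero    = cong₂ (λ b k → ⟦ b ⟧ + k) (is-refl zero)
  (trans (cnt-cong {n} (λ x → is zero (suc x)) ∅ (λ x → is-≢ {x = zero} {suc x} (λ ()))) (cnt-∅ {n}))
cnt-⁅⁆ {suc n} (suc a) = cong₂ (λ b k → ⟦ b ⟧ + k) (is-≢ {x = suc a} {zero} (λ ()))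
  (trans (cnt-cong (λ x → is (suc a) (suc x)) ⁅ a ⁆ (is-suc a)) (cnt-⁅⁆ a))

cnt-∪ : (A B : BSet n) → cnt (A ∪ B) ≤ cnt A + cnt B
cnt-∪ {n} A B = begin
  cnt (A ∪ B)              ≡⟨ sym (+-identityʳ _) ⟩
  cnt (A ∪ B) + 0          ≡⟨ cong (cnt (A ∪ B) +_) (sym (cnt-∅ {n})) ⟩
  cnt (A ∪ B) + cnt {n} ∅  ≤⟨ cnt-≤₂ (A ∪ B) ∅ A B (λ x → lem (A x) (B x)) ⟩
  cnt A + cnt B            ∎
  where
  open ≤-Reasoning
  lem : ∀ a b → ⟦ a ∨ b ⟧ + 0 ≤ ⟦ a ⟧ + ⟦ b ⟧
  lem true  b = s≤s z≤n
  lem false b = ≤-reflexive (+-identityʳ _)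

cnt-disjoint : (A B C : BSet n) → A ⊆ C → B ⊆ C → (∀ {x} → x ∈ A → x ∉ B) → cnt A + cnt B ≤ cnt C
cnt-disjoint {n} A B C p q r = begin
  cnt A + cnt B      ≤⟨ cnt-≤₂ A B C ∅ (λ x → lem (A x) (B x) (C x) p q r) ⟩
  cnt C + cnt {n} ∅  ≡⟨ cong (cnt C +_) (cnt-∅ {n}) ⟩
  cnt C + 0          ≡⟨ +-identityʳ _ ⟩
  cnt C              ∎
  where
  open ≤-Reasoning
  lem : ∀ a b c → (a ≡ true → c ≡ true) → (b ≡ true → c ≡ true) → (a ≡ true → b ≡ false) →
        ⟦ a ⟧ + ⟦ b ⟧ ≤ ⟦ c ⟧ + 0
  lem true  b     c p q r rewrite p refl | r refl = ≤-refl
  lem false true  c p q r rewrite q refl = ≤-refl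
  lem false false c p q r = z≤n

cnt-insert : (A B : BSet n) (a : Fin n) → A ⊆ B → a ∈ B → a ∉ A → suc (cnt A) ≤ cnt B
cnt-insert A B a p q r = subst (λ k → k + cnt A ≤ cnt B) (cnt-⁅⁆ a)
  (cnt-disjoint ⁅ a ⁆ A B (λ e → subst (_∈ B) (is-true e) q) p (λ e → subst (_∉ A) (is-true e) r))

cnt-cover : (A B : BSet n) (a : Fin n) → (∀ {x} → x ∈ A → a ≢ x → x ∈ B) → cnt A ≤ suc (cnt B)
cnt-cover A B a p = ≤-trans (cnt-mono A (⁅ a ⁆ ∪ B) lem)
  (≤-trans (cnt-∪ ⁅ a ⁆ B) (≤-reflexive (cong (_+ cnt B) (cnt-⁅⁆ a))))
  where
  lem : A ⊆ ⁅ a ⁆ ∪ B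
  lem {x} q with a ≟ x
  ... | yes refl = ∨-introˡ (is-refl a)
  ... | no a≢x   = ∨-introʳ (is a x) (p q a≢x)

cnt-gap : (A B : BSet n) → cnt A < cnt B → ∃ λ x → x ∈ B × x ∉ A
cnt-gap A B lt with any? (λ x → Bool._≟_ (B x ∧ not (A x)) true)
... | yes (x , p) = x , proj₁ (∧-elim p) , not-true (proj₂ (∧-elim p))
... | no ¬p = contradiction (<-≤-trans lt (cnt-mono B A B⊆A)) (<-irrefl refl)
  where
  B⊆A : B ⊆ A
  B⊆A {x} q with ∈? A x
  ... | inj₁ r = r
  ... | inj₂ r = contradiction (x , ∧-intro q (not-intro r)) ¬p

cnt-pos : (A : BSet n) → 0 < cnt A → ∃ (_∈ A)
cnt-pos {n} A lt with cnt-gap ∅ A (subst (_< cnt A) (sym (cnt-∅ {n})) lt)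
... | x , p , _ = x , p

pick : {N : ℕ} (A : BSet N) → n ≤ cnt A → Σ[ f ∈ (Fin n → Fin N) ] Injective _≡_ _≡_ f × (∀ i → f i ∈ A)
pick {zero}  A p = (λ ()) , (λ { {()} }) , λ ()
pick {suc n} {N} A p with cnt-pos A (<-≤-trans z<s p)
... | a , a∈A with pick {n} (A ∖ a) (s≤s⁻¹ (≤-trans p (cnt-cover A (A ∖ a) a (∖-∈ A))))
... | f , f-inj , f∈ = g , g-inj , g∈
  where
  g : Fin (suc n) → Fin N
  g zero    = a
  g (suc i) = f i
  g-inj : Injective _≡_ _≡_ g
  g-inj {zero}  {zero}  eq = refl
  g-inj {zero}  {suc j} eq = contradiction eq (proj₂ (∖-⊆ A (f∈ j)))
  g-inj {suc i} {zero}  eq = contradiction (sym eq) (proj₂ (∖-⊆ A (f∈ i)))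
  g-inj {suc i} {suc j} eq = cong suc (f-inj eq)
  g∈ : ∀ i → g i ∈ A
  g∈ zero    = a∈A
  g∈ (suc i) = proj₁ (∖-⊆ A (f∈ i))

-- The search runs over subset vectors, and a Boolean set agrees with its vector only pointwise; the
-- closure of `P` under `≗` stands in for function extensionality.
search : ∀ {ℓ} {P : BSet n → Set ℓ} → (∀ {A B} → A ≗ B → P A → P B) → (∀ A → Dec (P A)) → Dec (∃ P)
search resp P? = map′ (λ (s , p) → lookup s , p)
  (λ (A , p) → tabulate A , resp (λ x → sym (lookup∘tabulate A x)) p) (anySubset? (λ s → P? (lookup s)))

⊆? : (A B : BSet n) → A ⊆ B ⊎ ∃ λ x → x ∈ A × x ∉ B
⊆? A B with any? (λ x → Bool._≟_ (A x ∧ not (B x)) true)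
... | yes (x , p) = inj₂ (x , proj₁ (∧-elim p) , not-true (proj₂ (∧-elim p)))
... | no ¬p = inj₁ sub
  where
  sub : A ⊆ B
  sub {x} q with ∈? B x
  ... | inj₁ r = r
  ... | inj₂ r = contradiction (x , ∧-intro q (not-intro r)) ¬p

-- While some member of the family misses a point of `A`, intersecting with that member makes `A`
-- smaller; once the search finds none, `A` lies in all of them.
least : ∀ {ℓ} {P : BSet n → Set ℓ} → (∀ {A B} → A ≗ B → P A → P B) → (∀ A → Dec (P A)) →
        (∀ {A B} → P A → P B → P (A ∩ B)) → ∀ A → P A → ∃ λ Y → P Y × (∀ X → P X → Y ⊆ X)
least {n} {P = P} resp P? inter A p = go (suc (cnt A)) A p ≤-refl
  where
  Bad : BSet n → BSet n → Set _
  Bad A X = P X × ∃ λ x → x ∈ A × x ∉ X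
  Bad? : ∀ A X → Dec (Bad A X)
  Bad? A X with P? X | ⊆? A X
  ... | no ¬p | _      = no (¬p ∘ proj₁)
  ... | yes p | inj₁ s = no (λ (_ , x , q , r) → ∈∉ (s q) r)
  ... | yes p | inj₂ w = yes (p , w)
  go : ∀ fuel A → P A → cnt A < fuel → ∃ λ Y → P Y × (∀ X → P X → Y ⊆ X)
  go (suc fuel) A p lt with search (λ eq (q , x , r , s) → resp eq q , x , r , trans (sym (eq x)) s) (Bad? A)
  ... | yes (X , q , x , r , s) = go fuel (A ∩ X) (inter p q)
        (≤-trans (cnt-insert (A ∩ X) A x (proj₁ ∘ ∧-elim) r (∧-falseʳ (A x) s)) (s≤s⁻¹ lt))
  ... | no ¬q = A , p , λ X q → λ {x} r → case-∈ X q x r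
    where
    case-∈ : ∀ X → P X → ∀ x → x ∈ A → x ∈ X
    case-∈ X q x r with ∈? X x
    ... | inj₁ s = s
    ... | inj₂ s = contradiction (X , q , x , r , s) ¬q

choose : ∀ {a b} {A : Fin n → Set a} {B : Set b} → (∀ i → A i ⊎ B) → (∀ i → A i) ⊎ B
choose {zero}  f = inj₁ (λ ())
choose {suc n} f with f zero | choose (f ∘ suc)
... | inj₂ b | _      = inj₂ b
... | inj₁ a | inj₂ b = inj₂ b
... | inj₁ a | inj₁ g = inj₁ (λ { zero → a ; (suc i) → g i })

set : ∀ {a} {A : Set a} → (Fin n → A) → Fin n → A → Fin n → A
set f i x = updateAt f i (λ _ → x)

set-same : ∀ {a} {A : Set a} (f : Fin n → A) i x → set f i x i ≡ x
set-same f i x = updateAt-updates i f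

set-other : ∀ {a} {A : Set a} (f : Fin n → A) i x {j} → i ≢ j → set f i x j ≡ f j
set-other f i x {j} i≢j = updateAt-minimal j i f (i≢j ∘ sym)

∪-elim : (A B : BSet n) {x : Fin n} → x ∈ A ∪ B → x ∈ A ⊎ x ∈ B
∪-elim A B p = ∨-elim p

∩-elim : (A B : BSet n) {x : Fin n} → x ∈ A ∩ B → x ∈ A × x ∈ B
∩-elim A B p = ∧-elim p

-- Edge cuts, submodularity, connectedness and components

module Cuts {V E : ℕ} (src tgt : Fin E → Fin V) where

  Ends : Fin E → Fin V → Fin V → Set
  Ends e u v = (src e ≡ u × tgt e ≡ v) ⊎ (src e ≡ v × tgt e ≡ u)

  Inc : Fin E → Fin V → Set
  Inc e v = src e ≡ v ⊎ tgt e ≡ v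

  Ends-sym : ∀ {e u v} → Ends e u v → Ends e v u
  Ends-sym (inj₁ p) = inj₂ p
  Ends-sym (inj₂ p) = inj₁ p

  Ends⇒Incˡ : ∀ {e u v} → Ends e u v → Inc e u
  Ends⇒Incˡ (inj₁ (p , _)) = inj₁ p
  Ends⇒Incˡ (inj₂ (_ , p)) = inj₂ p

  Ends⇒Inc : ∀ {e u v x} → Ends e u v → Inc e x → x ≡ u ⊎ x ≡ v
  Ends⇒Inc (inj₁ (refl , refl)) (inj₁ p) = inj₁ (sym p)
  Ends⇒Inc (inj₁ (refl , refl)) (inj₂ p) = inj₂ (sym p)
  Ends⇒Inc (inj₂ (refl , refl)) (inj₁ p) = inj₂ (sym p)
  Ends⇒Inc (inj₂ (refl , refl)) (inj₂ p) = inj₁ (sym p)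

  ∂ : BSet V → BSet E
  ∂ X e = X (src e) xor X (tgt e)

  size : BSet E → BSet V → ℕ
  size Z X = cnt (Z ∩ ∂ X)

  -- Cut form of "Z contains a walk from a to b".
  Conn : BSet E → Fin V → Fin V → Set
  Conn Z a b = ∀ X → a ∈ X → b ∉ X → ∃ λ e → e ∈ Z × e ∈ ∂ X

  ∂-cong : ∀ {X Y} → X ≗ Y → ∂ X ≗ ∂ Y
  ∂-cong p e = cong₂ _xor_ (p (src e)) (p (tgt e))

  size-cong : ∀ Z {X Y} → X ≗ Y → size Z X ≡ size Z Y
  size-cong Z {X} {Y} p = cnt-cong (Z ∩ ∂ X) (Z ∩ ∂ Y) (λ e → cong (Z e ∧_) (∂-cong p e))

  size-mono : ∀ {Z Z′} X → Z ⊆ Z′ → size Z X ≤ size Z′ X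
  size-mono {Z} {Z′} X p = cnt-mono (Z ∩ ∂ X) (Z′ ∩ ∂ X) (λ q → ∧-intro (p (proj₁ (∧-elim q))) (proj₂ (∧-elim q)))

  ∂-Ends : ∀ {e u v} X → Ends e u v → u ∈ X → v ∉ X → e ∈ ∂ X
  ∂-Ends X (inj₁ (refl , refl)) p q rewrite p | q = refl
  ∂-Ends X (inj₂ (refl , refl)) p q rewrite p | q = refl

  ∂⇒Ends : ∀ {e} X → e ∈ ∂ X → ∃ λ u → ∃ λ v → Ends e u v × u ∈ X × v ∉ X
  ∂⇒Ends {e} X p with X (src e) in eq | X (tgt e) in eq′
  ... | true  | false = src e , tgt e , inj₁ (refl , refl) , eq , eq′
  ... | false | true  = tgt e , src e , inj₂ (refl , refl) , eq′ , eq

  ∂-Ends-∉ : ∀ {e u v} X → Ends e u v → X u ≡ X v → e ∉ ∂ X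
  ∂-Ends-∉ {v = v} X (inj₁ (refl , refl)) p rewrite p = Bool.xor-same (X v)
  ∂-Ends-∉ {v = v} X (inj₂ (refl , refl)) p rewrite p = Bool.xor-same (X v)

  private
    all-Bool? : ∀ {P : Bool → Set} → (∀ b → Dec (P b)) → Dec (∀ b → P b)
    all-Bool? P? = map′ (λ { (p , q) true → p ; (p , q) false → q }) (λ f → f true , f false)
      (P? true ×-dec P? false)

    -- The contribution of a single edge to submodularity, settled by evaluating all 32 Boolean
    -- cases.
    submodular-edge : ∀ z a b p q →
      ⟦ z ∧ ((a ∧ p) xor (b ∧ q)) ⟧ + ⟦ z ∧ ((a ∨ p) xor (b ∨ q)) ⟧ ≤ ⟦ z ∧ (a xor b) ⟧ + ⟦ z ∧ (p xor q) ⟧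
    submodular-edge = from-yes (all-Bool? λ z → all-Bool? λ a → all-Bool? λ b → all-Bool? λ p → all-Bool? λ q →
      (⟦ z ∧ ((a ∧ p) xor (b ∧ q)) ⟧ + ⟦ z ∧ ((a ∨ p) xor (b ∨ q)) ⟧) ≤? (⟦ z ∧ (a xor b) ⟧ + ⟦ z ∧ (p xor q) ⟧))

  submodular : ∀ Z X Y → size Z (X ∩ Y) + size Z (X ∪ Y) ≤ size Z X + size Z Y
  submodular Z X Y = cnt-≤₂ (Z ∩ ∂ (X ∩ Y)) (Z ∩ ∂ (X ∪ Y)) (Z ∩ ∂ X) (Z ∩ ∂ Y) 
    (λ e → submodular-edge (Z e) (X (src e)) (X (tgt e)) (Y (src e)) (Y (tgt e)))

  ∂-∁ : ∀ X → ∂ (∁ X) ≗ ∂ X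
  ∂-∁ X e with X (src e) | X (tgt e)
  ... | true  | b = refl
  ... | false | b = Bool.not-involutive b

  size-∁ : ∀ Z X → size Z (∁ X) ≡ size Z X
  size-∁ Z X = cnt-cong (Z ∩ ∂ (∁ X)) (Z ∩ ∂ X) (λ e → cong (Z e ∧_) (∂-∁ X e))

  crossing? : ∀ Z X → (∃ λ e → e ∈ Z × e ∈ ∂ X) ⊎ (∀ {e} → e ∈ Z → e ∉ ∂ X)
  crossing? Z X with any? (λ e → (Z ∩ ∂ X) e Bool.≟ true)
  ... | yes (e , p) = inj₁ (e , ∧-elim p)
  ... | no ¬p = inj₂ none
    where
    none : ∀ {e} → e ∈ Z → e ∉ ∂ X
    none {e} p with ∈? (∂ X) e
    ... | inj₁ q = contradiction (e , ∧-intro p q) ¬p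
    ... | inj₂ q = q

  size≡0 : ∀ {Z} X → (∀ {e} → e ∈ Z → e ∉ ∂ X) → size Z X ≡ 0
  size≡0 {Z} X p = trans (cnt-cong (Z ∩ ∂ X) ∅ lem) (cnt-∅ {E})
    where
    lem : Z ∩ ∂ X ≗ ∅
    lem e with ∈? Z e
    ... | inj₁ q = ∧-falseʳ (Z e) (p q)
    ... | inj₂ q = ∧-falseˡ _ q

  size≥1⇒cross : ∀ {Z} X → 1 ≤ size Z X → ∃ λ e → e ∈ Z × e ∈ ∂ X
  size≥1⇒cross {Z} X p with cnt-pos (Z ∩ ∂ X) p
  ... | e , q = e , ∧-elim q

  size-remove : ∀ Z e X → size Z X ≤ suc (size (Z ∖ e) X)
  size-remove Z e X = cnt-cover (Z ∩ ∂ X) (Z ∖ e ∩ ∂ X) e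
    (λ p e≢ → ∧-intro (∖-∈ Z (proj₁ (∧-elim p)) e≢) (proj₂ (∧-elim p)))

  size-remove-∉ : ∀ Z e X → e ∉ ∂ X → size Z X ≤ size (Z ∖ e) X
  size-remove-∉ Z e X e∉ = cnt-mono (Z ∩ ∂ X) (Z ∖ e ∩ ∂ X)
    (λ p → ∧-intro (∖-∈ Z (proj₁ (∧-elim p)) (λ { refl → ∈∉ (proj₂ (∧-elim p)) e∉ })) (proj₂ (∧-elim p)))

  Conn-refl : ∀ {Z a} → Conn Z a a
  Conn-refl X p q = ∈∉ p q

  Conn-trans : ∀ {Z a b c} → Conn Z a b → Conn Z b c → Conn Z a c
  Conn-trans {b = b} p q X a∈ c∉ with ∈? X b
  ... | inj₁ b∈ = q X b∈ c∉
  ... | inj₂ b∉ = p X a∈ b∉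

  Conn-sym : ∀ {Z a b} → Conn Z a b → Conn Z b a
  Conn-sym p X b∈ a∉ with p (∁ X) (not-intro a∉) (cong not b∈)
  ... | e , q , r = e , q , trans (sym (∂-∁ X e)) r

  Conn-mono : ∀ {Z Z′ a b} → Z ⊆ Z′ → Conn Z a b → Conn Z′ a b
  Conn-mono s p X a∈ b∉ with p X a∈ b∉
  ... | e , q , r = e , s q , r

  Conn-edge : ∀ {Z e u v} → e ∈ Z → Ends e u v → Conn Z u v
  Conn-edge {e = e} p j X u∈ v∉ = e , p , ∂-Ends X j u∈ v∉

  Step : BSet E → Fin V → Fin V → Set
  Step Z u v = ∃ λ e → e ∈ Z × Ends e u v

  Step⇒Conn : ∀ {Z u v} → Star (Step Z) u v → Conn Z u v
  Step⇒Conn ε = Conn-refl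
  Step⇒Conn ((e , p , j) ◅ s) = Conn-trans (Conn-edge p j) (Step⇒Conn s)

  -- Recovers the walks that the cut form `Conn` leaves implicit: `K` is the vertex set of the
  -- component of `c` in the graph with edge set `Z`.
  record Component (Z : BSet E) (c : Fin V) : Set where
    field
      K      : BSet V
      c∈     : c ∈ K
      closed : ∀ {e u v} → e ∈ Z → Ends e u v → u ∈ K → v ∈ K
      walk   : ∀ {x} → x ∈ K → Star (Step Z) c x

    Conn⇒∈ : ∀ {x} → Conn Z x c → x ∈ K
    Conn⇒∈ {x} p with ∈? K x
    ... | inj₁ q = q
    ... | inj₂ q with Conn-sym p K c∈ q
    ... | e , r , s with ∂⇒Ends K s
    ... | u , v , j , u∈ , v∉ = ∈∉ (closed r j u∈) v∉

    -- As `K` is closed under `Z`, it suffices to test one end of an edge.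
    Inside : BSet E
    Inside e = Z e ∧ K (src e)

    inside : ∀ {e u v} → e ∈ Z → Ends e u v → u ∈ K → e ∈ Inside
    inside e∈ j@(inj₁ (refl , _)) u∈ = ∧-intro e∈ u∈
    inside e∈ j@(inj₂ (refl , _)) u∈ = ∧-intro e∈ (closed e∈ j u∈)

    walk-inside : ∀ {x} → x ∈ K → Star (Step Inside) c x
    walk-inside x∈ = go c∈ (walk x∈)
      where
      go : ∀ {u x} → u ∈ K → Star (Step Z) u x → Star (Step Inside) u x
      go u∈ ε = ε
      go u∈ ((e , e∈ , j) ◅ s) = (e , inside e∈ j u∈ , j) ◅ go (closed e∈ j u∈) s

    ∈⇒Conn : ∀ {x} → x ∈ K → Conn Inside x c
    ∈⇒Conn p = Conn-sym (Step⇒Conn (walk-inside p))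

  component : ∀ Z c → Component Z c
  component Z c = go V ⁅ c ⁆ (is-refl c) (λ p → subst (Star (Step Z) c) (is-true p) ε)
                     (≤-trans (≤-reflexive (+-comm 1 V)) (+-monoʳ-≤ V (≤-reflexive (sym (cnt-⁅⁆ c)))))
    where
    go : ∀ fuel K → c ∈ K → (∀ {x} → x ∈ K → Star (Step Z) c x) → suc V ≤ fuel + cnt K → Component Z c
    go fuel K c∈ walk bound with crossing? Z K
    -- Out of fuel, the bound would give `K` more than `V` elements.
    go zero K c∈ walk bound | inj₁ _ = contradiction (≤-trans bound (cnt≤ K)) (<-irrefl refl)
    go (suc fuel) K c∈ walk bound | inj₁ (e , e∈ , cr) with ∂⇒Ends K cr
    ... | u , v , j , u∈ , v∉ = go fuel (K ∪ ⁅ v ⁆) (∨-introˡ c∈) walk′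
          (≤-trans (≤-trans bound (≤-reflexive (sym (+-suc fuel (cnt K)))))
            (+-monoʳ-≤ fuel (cnt-insert K (K ∪ ⁅ v ⁆) v ∨-introˡ (∨-introʳ (K v) (is-refl v)) v∉)))
      where
      walk′ : ∀ {x} → x ∈ K ∪ ⁅ v ⁆ → Star (Step Z) c x
      walk′ p with ∨-elim p
      ... | inj₁ q = walk q
      ... | inj₂ q = subst (Star (Step Z) c) (is-true q) (walk u∈ ◅◅ ((e , e∈ , j) ◅ ε))
    go fuel K c∈ walk bound | inj₂ none = record { K = K ; c∈ = c∈ ; closed = closed ; walk = walk }
      where
      closed : ∀ {e u v} → e ∈ Z → Ends e u v → u ∈ K → v ∈ K
      closed {v = v} p j u∈ with ∈? K v
      ... | inj₁ q = q
      ... | inj₂ q = ∈∉ (∂-Ends K j u∈ q) (none p)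

-- Menger's theorem for edge-disjoint connections to `c`

module Menger {V E : ℕ} (src tgt : Fin E → Fin V) (c : Fin V) where
  open Cuts src tgt

  private
    modular-bit : ∀ a b → ⟦ a ⟧ + ⟦ b ⟧ ≤ ⟦ a ∧ b ⟧ + ⟦ a ∨ b ⟧
    modular-bit true  b = ≤-reflexive (+-comm 1 ⟦ b ⟧)
    modular-bit false b = ≤-refl

  module _ {k : ℕ} where

    -- A token marks the current starting point of one of the `suc k` connections still to be built
    -- towards `c`.
    tok : (Fin (suc k) → Fin V) → BSet V → ℕ
    tok pos X = cnt (X ∘ pos)

    tok-cong : ∀ pos {X Y} → X ≗ Y → tok pos X ≡ tok pos Y
    tok-cong pos {X} {Y} p = cnt-cong (X ∘ pos) (Y ∘ pos) (p ∘ pos)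

    modular : ∀ pos X Y → tok pos X + tok pos Y ≤ tok pos (X ∩ Y) + tok pos (X ∪ Y)
    modular pos X Y = cnt-≤₂ (X ∘ pos) (Y ∘ pos) ((X ∩ Y) ∘ pos) ((X ∪ Y) ∘ pos)
      (λ i → modular-bit (X (pos i)) (Y (pos i)))

    tok-move-≤ : ∀ pos i z X → X z ≡ X (pos i) → tok (set pos i z) X ≤ tok pos X
    tok-move-≤ pos i z X eq = cnt-mono (X ∘ set pos i z) (X ∘ pos) sub
      where
      sub : X ∘ set pos i z ⊆ X ∘ pos
      sub {j} p with i ≟ j
      ... | yes refl = trans (sym eq) (trans (cong X (sym (set-same pos i z))) p)
      ... | no  i≢j  = trans (cong X (sym (set-other pos i z i≢j))) p

    tok-move-suc : ∀ pos i z X → tok (set pos i z) X ≤ suc (tok pos X)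
    tok-move-suc pos i z X = cnt-cover (X ∘ set pos i z) (X ∘ pos) i
      (λ p i≢j → trans (cong X (sym (set-other pos i z i≢j))) p)

    tok-move-out : ∀ pos i z X → pos i ∈ X → z ∉ X → suc (tok (set pos i z) X) ≤ tok pos X
    tok-move-out pos i z X p q = cnt-insert (X ∘ set pos i z) (X ∘ pos) i sub p (trans (cong X (set-same pos i z)) q)
      where
      sub : X ∘ set pos i z ⊆ X ∘ pos
      sub {j} r with i ≟ j
      ... | yes refl = p
      ... | no  i≢j  = trans (cong X (sym (set-other pos i z i≢j))) r

    Linked : BSet E → (Fin (suc k) → Fin V) → Set
    Linked Z pos = Σ[ lab ∈ (Fin E → Fin (suc k)) ] (∀ i → Conn (λ e → Z e ∧ is (lab e) i) (pos i) c)

    -- The cut condition of Menger's theorem, with the tokens as sources and `c` as the sink.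
    Feasible : BSet E → (Fin (suc k) → Fin V) → Set
    Feasible Z pos = ∀ X → c ∉ X → tok pos X ≤ size Z X

    linked-⊆ : ∀ {Z Z′ pos} → Z′ ⊆ Z → Linked Z′ pos → Linked Z pos
    linked-⊆ s (lab , f) = lab , λ i → Conn-mono (λ p → ∧-intro (s (proj₁ (∧-elim p))) (proj₂ (∧-elim p))) (f i)

    -- The remaining classes do not use `e`, so `e` can be added to class `i`, where it leads from
    -- the old position of the token to the new one.
    linked-move : ∀ {Z pos e z} i → e ∈ Z → Ends e (pos i) z → Linked (Z ∖ e) (set pos i z) → Linked Z pos
    linked-move {Z} {pos} {e} {z} i e∈ j (lab , f) = lab′ , g
      where
      lab′ : Fin E → Fin (suc k)
      lab′ = set lab e i
      sub : ∀ i′ → (λ e′ → (Z ∖ e) e′ ∧ is (lab e′) i′) ⊆ (λ e′ → Z e′ ∧ is (lab′ e′) i′)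
      sub i′ {e′} p with e ≟ e′
      ... | yes refl = ∈∉ (proj₁ (∧-elim p)) (∖-∉ Z e)
      ... | no  e≢e′ = ∧-intro (proj₁ (∖-⊆ Z (proj₁ (∧-elim p))))
                         (trans (cong (λ l → is l i′) (set-other lab e i e≢e′)) (proj₂ (∧-elim p)))
      g : ∀ i′ → Conn (λ e → Z e ∧ is (lab′ e) i′) (pos i′) c
      g i′ with i ≟ i′
      ... | yes refl = Conn-trans (Conn-edge (∧-intro e∈ (is-≡ (set-same lab e i))) j)
                         (Conn-mono (sub i) (subst (λ x → Conn _ x c) (set-same pos i z) (f i)))
      ... | no i≢i′ = Conn-mono (sub i′) (subst (λ x → Conn _ x c) (set-other pos i z i≢i′) (f i′))

    -- If U is a tight set without y, then some edge at y leaves U ∪ {y}.  Either it can be deleted, or deleting it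
    -- overloads a set X.  If y ∈ X, submodularity lets the token at y move along that edge; otherwise U ∪ X is a
    -- larger tight set without y.
    menger : ∀ fuel Z pos → cnt Z < fuel → Feasible Z pos → Linked Z pos
    menger (suc fuel) Z pos lt feas with any? (λ i → ¬? (pos i ≟ c))
    ... | no ¬p = (λ _ → zero) , λ i → lem i
      where
      lem : ∀ i → Conn (λ e → Z e ∧ is zero i) (pos i) c
      lem i with pos i ≟ c
      ... | yes eq = subst (λ x → Conn _ x c) (sym eq) Conn-refl
      ... | no neq = contradiction (i , neq) ¬p
    -- The empty set is the first tight set.
    ... | yes (i , y≢c) = find (suc V) ∅ refl refl
            (≤-trans (≤-reflexive (size≡0 {Z} ∅ (λ _ → refl))) z≤n) (m≤m+n (suc V) _)
      where
      y : Fin V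
      y = pos i
      find : ∀ fuel′ U → y ∉ U → c ∉ U → size Z U ≤ tok pos U → V < fuel′ + cnt U → Linked Z pos
      find zero U _ _ _ bound = contradiction (≤-trans bound (cnt≤ U)) (<-irrefl refl)
      -- Adding `y` to the tight set `U` adds at least the token `i`, so by feasibility more edges
      -- leave the new set than left `U`; one of them does not cross `U`.
      find (suc fuel′) U y∉ c∉ tight bound
        with cnt-gap (Z ∩ ∂ U) (Z ∩ ∂ (U ∪ ⁅ y ⁆))
               (≤-trans (s≤s tight) (≤-trans
                 (cnt-insert (U ∘ pos) ((U ∪ ⁅ y ⁆) ∘ pos) i ∨-introˡ (∨-introʳ (U y) (is-refl y)) y∉)
                 (feas (U ∪ ⁅ y ⁆) (∨-false c∉ (is-≢ y≢c)))))
      ... | e , e∈ , e∉ with ∂⇒Ends (U ∪ ⁅ y ⁆) (proj₂ (∧-elim e∈))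
      ... | u , z , j , u∈ , z∉ = result
        where
        e∈Z : e ∈ Z
        e∈Z = proj₁ (∧-elim e∈)
        z∉U : z ∉ U
        z∉U with ∈? U z
        ... | inj₁ z∈ = ∈∉ (∨-introˡ z∈) z∉
        ... | inj₂ p = p
        u≡y : u ≡ y
        u≡y with ∨-elim u∈
        ... | inj₁ u∈U = ∈∉ (∧-intro e∈Z (∂-Ends U j u∈U z∉U)) e∉
        ... | inj₂ p   = sym (is-true p)
        j′ : Ends e y z
        j′ = subst (λ u → Ends e u z) u≡y j
        fewer : cnt (Z ∖ e) < fuel
        fewer = ≤-trans (cnt-insert (Z ∖ e) Z e (λ p → proj₁ (∖-⊆ Z p)) e∈Z (∖-∉ Z e)) (s≤s⁻¹ lt)
        same : ∀ W → W z ≡ W y → size Z W ≤ size (Z ∖ e) W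
        same W eq = size-remove-∉ Z e W (∂-Ends-∉ W j′ (sym eq))
        Overload : BSet V → Set
        Overload X = c ∉ X × size (Z ∖ e) X < tok pos X
        moved : ∀ X → Overload X → y ∈ X → z ∉ X → Feasible (Z ∖ e) (set pos i z)
        moved X (c∉X , over) y∈X z∉X W c∉W with ∈? W y | ∈? W z
        ... | inj₁ y∈W | inj₁ z∈W = ≤-trans (tok-move-≤ pos i z W (trans z∈W (sym y∈W)))
                (≤-trans (feas W c∉W) (same W (trans z∈W (sym y∈W))))
        ... | inj₂ y∉W | inj₂ z∉W = ≤-trans (tok-move-≤ pos i z W (trans z∉W (sym y∉W)))
                (≤-trans (feas W c∉W) (same W (trans z∉W (sym y∉W))))
        ... | inj₁ y∈W | inj₂ z∉W = s≤s⁻¹ (≤-trans (tok-move-out pos i z W y∈W z∉W)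
                (≤-trans (feas W c∉W) (size-remove Z e W)))
        -- Only in this case can the move add a token to `W`. The overload of `X` pays for it,
        -- because `e` crosses neither `X ∩ W` nor `X ∪ W`.
        ... | inj₂ y∉W | inj₁ z∈W = +-cancelˡ-≤ (size (Z ∖ e) X) _ _ (begin
          size (Z ∖ e) X + tok (set pos i z) W  ≤⟨ +-monoʳ-≤ _ (tok-move-suc pos i z W) ⟩
          size (Z ∖ e) X + suc (tok pos W)      ≡⟨ +-suc _ _ ⟩
          suc (size (Z ∖ e) X) + tok pos W      ≤⟨ +-monoˡ-≤ _ over ⟩
          tok pos X + tok pos W                 ≤⟨ modular pos X W ⟩
          tok pos (X ∩ W) + tok pos (X ∪ W)
            ≤⟨ +-mono-≤ (≤-trans (feas (X ∩ W) (∧-falseˡ _ c∉X))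
                                 (same (X ∩ W) (trans (∧-falseˡ _ z∉X) (sym (∧-falseʳ (X y) y∉W)))))
                        (≤-trans (feas (X ∪ W) (∨-false c∉X c∉W))
                                 (same (X ∪ W) (trans (∨-introʳ (X z) z∈W) (sym (∨-introˡ y∈X))))) ⟩
          size (Z ∖ e) (X ∩ W) + size (Z ∖ e) (X ∪ W)             ≤⟨ submodular (Z ∖ e) X W ⟩
          size (Z ∖ e) X + size (Z ∖ e) W                         ∎)
          where open ≤-Reasoning
        result : Linked Z pos
        result with search (λ {A} {B} eq (p , q) → trans (sym (eq c)) p ,
                              subst₂ (λ m n → suc m ≤ n) (size-cong (Z ∖ e) eq) (tok-cong pos eq) q)
                           (λ X → (X c Bool.≟ false) ×-dec (size (Z ∖ e) X <? tok pos X))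
        ... | no ¬over = linked-⊆ (λ p → proj₁ (∖-⊆ Z p))
                (menger fuel (Z ∖ e) pos fewer (λ X c∉X → ≮⇒≥ (λ lt → ¬over (X , c∉X , lt))))
        ... | yes (X , c∉X , over) with ∈? X y | ∈? X z
        ... | inj₁ y∈X | inj₂ z∉X = linked-move i e∈Z j′
                (menger fuel (Z ∖ e) (set pos i z) fewer (moved X (c∉X , over) y∈X z∉X))
        ... | inj₁ y∈X | inj₁ z∈X =
                contradiction (≤-trans over (≤-trans (feas X c∉X) (same X (trans z∈X (sym y∈X))))) (<-irrefl refl)
        ... | inj₂ y∉X | inj₂ z∉X =
                contradiction (≤-trans over (≤-trans (feas X c∉X) (same X (trans z∉X (sym y∉X))))) (<-irrefl refl)
        ... | inj₂ y∉X | inj₁ z∈X = find fuel′ (U ∪ X) (∨-false y∉ y∉X) (∨-false c∉ c∉X) tight′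
                (≤-trans bound (≤-trans (≤-reflexive (sym (+-suc fuel′ (cnt U))))
                  (+-monoʳ-≤ fuel′ (cnt-insert U (U ∪ X) z ∨-introˡ (∨-introʳ (U z) z∈X) z∉U))))
          where
          -- Restoring the single edge `e` shows that the overloaded set `X` is tight for `Z`, and
          -- by submodularity a union of tight sets is tight.
          tight′ : size Z (U ∪ X) ≤ tok pos (U ∪ X)
          tight′ = +-cancelˡ-≤ (size Z (U ∩ X)) _ _ (begin
            size Z (U ∩ X) + size Z (U ∪ X)    ≤⟨ submodular Z U X ⟩
            size Z U + size Z X                ≤⟨ +-mono-≤ tight (≤-trans (size-remove Z e X) over) ⟩
            tok pos U + tok pos X              ≤⟨ modular pos U X ⟩
            tok pos (U ∩ X) + tok pos (U ∪ X)  ≤⟨ +-monoˡ-≤ _ (feas (U ∩ X) (∧-falseˡ _ c∉)) ⟩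
            size Z (U ∩ X) + tok pos (U ∪ X)          ∎)
            where open ≤-Reasoning

    -- All tokens start at `v`: a set with `v` holds all `suc k` of them, and any other set holds
    -- none.
    edge-disjoint-links : ∀ Z v → (∀ X → v ∈ X → c ∉ X → suc k ≤ size Z X) →
      Σ[ lab ∈ (Fin E → Fin (suc k)) ] (∀ i → Conn (λ e → Z e ∧ is (lab e) i) v c)
    edge-disjoint-links Z v cut = menger (suc (cnt Z)) Z (λ _ → v) ≤-refl feas
      where
      feas : Feasible Z (λ _ → v)
      feas X c∉ with ∈? X v
      ... | inj₁ v∈ = ≤-trans (cnt≤ {suc k} (λ _ → X v)) (cut X v∈ c∉)
      ... | inj₂ v∉ = ≤-trans (≤-reflexive (trans (cnt-cong {suc k} (λ _ → X v) ∅ (λ _ → v∉)) (cnt-∅ {suc k}))) z≤n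

-- Parity, and the pairing of tokens by a T-join

parity : {n : ℕ} → BSet n → Bool
parity {zero}  A = false
parity {suc n} A = A zero xor parity (A ∘ suc)

parity-cong : {n : ℕ} (A B : BSet n) → A ≗ B → parity A ≡ parity B
parity-cong {zero}  A B p = refl
parity-cong {suc n} A B p = cong₂ _xor_ (p zero) (parity-cong (A ∘ suc) (B ∘ suc) (p ∘ suc))

private
  xor-cancelˡ : ∀ x a b → (x xor a) xor (x xor b) ≡ a xor b
  xor-cancelˡ false a     b = refl
  xor-cancelˡ true  true  true  = refl
  xor-cancelˡ true  true  false = refl
  xor-cancelˡ true  false true  = refl
  xor-cancelˡ true  false false = refl

  xor-cancelʳ : ∀ x a b → (a xor x) xor (b xor x) ≡ a xor b
  xor-cancelʳ x a b = trans (cong₂ _xor_ (Bool.xor-comm a x) (Bool.xor-comm b x)) (xor-cancelˡ x a b)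

  xor-interchange : ∀ a b p q → (a xor b) xor (p xor q) ≡ (a xor p) xor (b xor q)
  xor-interchange false b p q = trans (sym (Bool.xor-assoc b p q))
    (trans (cong (_xor q) (Bool.xor-comm b p)) (Bool.xor-assoc p b q))
  xor-interchange true  b p q = trans (sym (Bool.not-distribˡ-xor b (p xor q)))
    (trans (cong not (xor-interchange false b p q)) (Bool.not-distribˡ-xor p (b xor q)))

parity-∅ : {n : ℕ} → parity {n} ∅ ≡ false
parity-∅ {zero}  = refl
parity-∅ {suc n} = parity-∅ {n}

parity-xor : {n : ℕ} (A B : BSet n) → parity (λ x → A x xor B x) ≡ parity A xor parity B
parity-xor {zero}  A B = refl
parity-xor {suc n} A B = trans (cong ((A zero xor B zero) xor_) (parity-xor (A ∘ suc) (B ∘ suc)))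
  (xor-interchange (A zero) (B zero) _ _)

parity-flip : {n : ℕ} (A B : BSet n) (a : Fin n) → (∀ {x} → a ≢ x → A x ≡ B x) → parity A xor parity B ≡ A a xor B a
parity-flip {suc n} A B zero    p
  rewrite parity-cong (A ∘ suc) (B ∘ suc) (λ x → p (λ ())) = xor-cancelʳ (parity (B ∘ suc)) (A zero) (B zero)
parity-flip {suc n} A B (suc a) p rewrite p {zero} (λ ()) = trans (xor-cancelˡ (B zero) _ _)
  (parity-flip (A ∘ suc) (B ∘ suc) a (λ a≢x → p (a≢x ∘ suc-injective)))

xor≡false : ∀ {a b} → a xor b ≡ false → a ≡ b
xor≡false {true}  {true}  _ = refl
xor≡false {false} {false} _ = refl

module Pairing {V E : ℕ} (src tgt : Fin E → Fin V) (c : Fin V) where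
  open Cuts src tgt

  -- Tokens are named by vertices; token a lies at pos a.
  odd : BSet V → (Fin V → Fin V) → BSet V → Bool
  odd A pos X = parity (λ a → A a ∧ X (pos a))

  -- The solvability condition for T-joins on the components of `Z`, except that the component of
  -- `c` may hold any number of tokens, since `c` absorbs the surplus.
  Even : BSet E → BSet V → (Fin V → Fin V) → Set
  Even Z A pos = ∀ X → c ∉ X → size Z X ≡ 0 → odd A pos X ≡ false

  -- W holds the tokens linked to c and one token of each pair, and φ maps each token to the member of W in its pair.
  record Paired (Z : BSet E) (A : BSet V) (pos : Fin V → Fin V) : Set where
    field
      W    : BSet V
      W⊆A  : W ⊆ A
      half : cnt A ≤ 2 * cnt W
      φ    : Fin V → Fin V
      φ-W  : ∀ {w} → w ∈ W → φ w ≡ w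
      lab  : Fin E → Fin V
    Class : Fin V → BSet E
    Class w e = Z e ∧ is (lab e) w
    field
      link : ∀ {w} → w ∈ W → Conn (Class w) (pos w) c ⊎
             ∃ λ l → l ∈ A × l ∉ W × φ l ≡ w × Conn (Class w) (pos w) (pos l)

  private
    double-suc : ∀ {a w w′} → a ≤ 2 * w → suc w ≤ w′ → suc (suc a) ≤ 2 * w′
    double-suc {a} {w} {w′} p q = ≤-trans (s≤s (s≤s p)) (≤-trans (≤-reflexive (sym (*-suc 2 w))) (*-monoʳ-≤ 2 q))

  odd-remove : ∀ A pos a X → a ∈ A → odd A pos X ≡ X (pos a) xor odd (A ∖ a) pos X
  odd-remove A pos a X a∈ = begin
    p                ≡⟨ sym (Bool.xor-identityʳ p) ⟩
    p xor false      ≡⟨ cong (p xor_) (sym (Bool.xor-same q)) ⟩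
    p xor (q xor q)  ≡⟨ sym (Bool.xor-assoc p q q) ⟩
    (p xor q) xor q  ≡⟨ cong (_xor q) (parity-flip _ _ a agree) ⟩
    ((A a ∧ X (pos a)) xor ((A ∖ a) a ∧ X (pos a))) xor q
      ≡⟨ cong (_xor q) (cong₂ (λ s t → (s ∧ X (pos a)) xor (t ∧ X (pos a))) a∈ (∖-∉ A a)) ⟩
    (X (pos a) xor false) xor q  ≡⟨ cong (_xor q) (Bool.xor-identityʳ (X (pos a))) ⟩
    X (pos a) xor q              ∎
    where
    open ≡-Reasoning
    p = odd A pos X
    q = odd (A ∖ a) pos X
    agree : ∀ {x} → a ≢ x → A x ∧ X (pos x) ≡ (A ∖ a) x ∧ X (pos x)
    agree {x} a≢x rewrite is-≢ a≢x = cong (_∧ X (pos x)) (sym (Bool.∧-identityʳ (A x)))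

  -- A token that has reached `c` enters `W`, linked to `c` by an empty connection.
  paired-arrive : ∀ {Z A pos a} → a ∈ A → pos a ≡ c → Paired Z (A ∖ a) pos → Paired Z A pos
  paired-arrive {Z} {A} {pos} {a} a∈ pa≡c P = record
    { W = W ∪ ⁅ a ⁆ ; W⊆A = W′⊆A
    ; half = ≤-trans (n≤1+n _) (≤-trans (s≤s (cnt-cover A (A ∖ a) a (∖-∈ A)))
               (double-suc half (cnt-insert W (W ∪ ⁅ a ⁆) a ∨-introˡ (∨-introʳ (W a) (is-refl a)) a∉W)))
    ; φ = set φ a a ; φ-W = φ-W′ ; lab = lab ; link = link′ }
    where
    open Paired P
    a∉W : a ∉ W
    a∉W with ∈? W a
    ... | inj₁ p = ∈∉ (W⊆A p) (∖-∉ A a)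
    ... | inj₂ p = p
    W′⊆A : W ∪ ⁅ a ⁆ ⊆ A
    W′⊆A p with ∪-elim W ⁅ a ⁆ p
    ... | inj₁ q = proj₁ (∖-⊆ A (W⊆A q))
    ... | inj₂ q = subst (_∈ A) (is-true q) a∈
    φ-W′ : ∀ {w} → w ∈ W ∪ ⁅ a ⁆ → set φ a a w ≡ w
    φ-W′ {w} p with a ≟ w
    ... | yes refl = set-same φ a a
    ... | no a≢w with ∪-elim W ⁅ a ⁆ p
    ... | inj₁ q = trans (set-other φ a a a≢w) (φ-W q)
    ... | inj₂ q = contradiction (is-true q) a≢w
    link′ : ∀ {w} → w ∈ W ∪ ⁅ a ⁆ → Conn (Class w) (pos w) c ⊎
            ∃ λ l → l ∈ A × l ∉ W ∪ ⁅ a ⁆ × set φ a a l ≡ w × Conn (Class w) (pos w) (pos l)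
    link′ {w} p with ∪-elim W ⁅ a ⁆ p
    ... | inj₂ q = inj₁ (subst (λ x → Conn _ x c) (trans (sym pa≡c) (cong pos (is-true q))) Conn-refl)
    ... | inj₁ q with link q
    ... | inj₁ r = inj₁ r
    ... | inj₂ (l , l∈ , l∉ , eq , r) with ∖-⊆ A l∈
    ... | l∈A , a≢l = inj₂ (l , l∈A , ∨-false l∉ (is-≢ a≢l) , trans (set-other φ a a a≢l) eq , r)

  -- Two tokens at one vertex form a pair with an empty connection; `a` represents it in `W`, and
  -- `φ` sends `b` to `a`.
  paired-meet : ∀ {Z A pos a b} → a ∈ A → b ∈ A → a ≢ b → pos a ≡ pos b → Paired Z (A ∖ a ∖ b) pos → Paired Z A pos
  paired-meet {Z} {A} {pos} {a} {b} a∈ b∈ a≢b pa≡pb P = record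
    { W = W ∪ ⁅ a ⁆ ; W⊆A = W′⊆A
    ; half = ≤-trans (cnt-cover A (A ∖ a) a (∖-∈ A))
               (≤-trans (s≤s (cnt-cover (A ∖ a) (A ∖ a ∖ b) b (∖-∈ (A ∖ a))))
               (double-suc half (cnt-insert W (W ∪ ⁅ a ⁆) a ∨-introˡ (∨-introʳ (W a) (is-refl a)) a∉W)))
    ; φ = φ′ ; φ-W = φ-W′ ; lab = lab ; link = link′ }
    where
    open Paired P
    φ′ = set (set φ b a) a a
    ⊆A : ∀ {x} → x ∈ A ∖ a ∖ b → x ∈ A × a ≢ x × b ≢ x
    ⊆A p with ∖-⊆ (A ∖ a) p
    ... | q , b≢ with ∖-⊆ A q
    ... | r , a≢ = r , a≢ , b≢
    a∉W : a ∉ W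
    a∉W with ∈? W a
    ... | inj₁ p = contradiction refl (proj₁ (proj₂ (⊆A (W⊆A p))))
    ... | inj₂ p = p
    b∉W : b ∉ W
    b∉W with ∈? W b
    ... | inj₁ p = contradiction refl (proj₂ (proj₂ (⊆A (W⊆A p))))
    ... | inj₂ p = p
    W′⊆A : W ∪ ⁅ a ⁆ ⊆ A
    W′⊆A p with ∪-elim W ⁅ a ⁆ p
    ... | inj₁ q = proj₁ (⊆A (W⊆A q))
    ... | inj₂ q = subst (_∈ A) (is-true q) a∈
    φ′-other : ∀ {x} → a ≢ x → b ≢ x → φ′ x ≡ φ x
    φ′-other a≢ b≢ = trans (set-other (set φ b a) a a a≢) (set-other φ b a b≢)
    φ-W′ : ∀ {w} → w ∈ W ∪ ⁅ a ⁆ → φ′ w ≡ w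
    φ-W′ {w} p with ∪-elim W ⁅ a ⁆ p
    ... | inj₁ q = trans (φ′-other (proj₁ (proj₂ (⊆A (W⊆A q)))) (proj₂ (proj₂ (⊆A (W⊆A q))))) (φ-W q)
    ... | inj₂ q = subst (λ w → φ′ w ≡ w) (is-true q) (set-same (set φ b a) a a)
    link′ : ∀ {w} → w ∈ W ∪ ⁅ a ⁆ → Conn (Class w) (pos w) c ⊎
            ∃ λ l → l ∈ A × l ∉ W ∪ ⁅ a ⁆ × φ′ l ≡ w × Conn (Class w) (pos w) (pos l)
    link′ {w} p with ∪-elim W ⁅ a ⁆ p
    ... | inj₂ q rewrite sym (is-true q) = inj₂ (b , b∈ , ∨-false b∉W (is-≢ a≢b) ,
            trans (set-other (set φ b a) a a a≢b) (set-same φ b a) ,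
            subst (Conn _ (pos a)) pa≡pb Conn-refl)
    ... | inj₁ q with link q
    ... | inj₁ r = inj₁ r
    ... | inj₂ (l , l∈ , l∉ , eq , r) with ⊆A l∈
    ... | l∈A , a≢l , b≢l = inj₂ (l , l∈A , ∨-false l∉ (is-≢ a≢l) , trans (φ′-other a≢l b≢l) eq , r)

  paired-⊆ : ∀ {Z Z′ A pos} → Z′ ⊆ Z → Paired Z′ A pos → Paired Z A pos
  paired-⊆ {Z} {Z′} {A} {pos} s P = record
    { W = W ; W⊆A = W⊆A ; half = half ; φ = φ ; φ-W = φ-W ; lab = lab ; link = link′ }
    where
    open Paired P
    sub : ∀ {w} → Class w ⊆ (λ e → Z e ∧ is (lab e) w)
    sub p = ∧-intro (s (proj₁ (∧-elim p))) (proj₂ (∧-elim p))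
    link′ : ∀ {w} → w ∈ W → Conn (λ e → Z e ∧ is (lab e) w) (pos w) c ⊎
            ∃ λ l → l ∈ A × l ∉ W × φ l ≡ w × Conn (λ e → Z e ∧ is (lab e) w) (pos w) (pos l)
    link′ p with link p
    ... | inj₁ r = inj₁ (Conn-mono sub r)
    ... | inj₂ (l , q₁ , q₂ , q₃ , r) = inj₂ (l , q₁ , q₂ , q₃ , Conn-mono sub r)

  -- The new edge is labelled `φ a` rather than `a`: the connection of a pair is named after its
  -- member in `W`, so it can be extended under the same name at either end.
  paired-move : ∀ {Z A pos a e z} → e ∈ Z → Ends e (pos a) z → Paired (Z ∖ e) A (set pos a z) → Paired Z A pos
  paired-move {Z} {A} {pos} {a} {e} {z} e∈ j P = record
    { W = W ; W⊆A = W⊆A ; half = half ; φ = φ ; φ-W = φ-W ; lab = lab′ ; link = link′ }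
    where
    open Paired P
    lab′ = set lab e (φ a)
    Class′ : Fin V → BSet E
    Class′ w f = Z f ∧ is (lab′ f) w
    sub : ∀ {w} → Class w ⊆ Class′ w
    sub {w} {f} p with e ≟ f
    ... | yes refl = ∈∉ (proj₁ (∧-elim p)) (∖-∉ Z e)
    ... | no e≢f = ∧-intro (proj₁ (∖-⊆ Z (proj₁ (∧-elim p))))
                     (trans (cong (λ l → is l w) (set-other lab e (φ a) e≢f)) (proj₂ (∧-elim p)))
    start : ∀ x → Conn (Class′ (φ x)) (pos x) (set pos a z x)
    start x with a ≟ x
    ... | yes refl = subst (Conn _ (pos a)) (sym (set-same pos a z))
                       (Conn-edge (∧-intro e∈ (is-≡ (set-same lab e (φ a)))) j)
    ... | no a≢x = subst (Conn _ (pos x)) (sym (set-other pos a z a≢x)) Conn-refl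
    link′ : ∀ {w} → w ∈ W → Conn (Class′ w) (pos w) c ⊎
            ∃ λ l → l ∈ A × l ∉ W × φ l ≡ w × Conn (Class′ w) (pos w) (pos l)
    link′ {w} p with link p
    ... | inj₁ r = inj₁ (Conn-trans (subst (λ v → Conn (Class′ v) (pos w) (set pos a z w)) (φ-W p) (start w))
                      (Conn-mono sub r))
    ... | inj₂ (l , l∈ , l∉ , eq , r) = inj₂ (l , l∈ , l∉ , eq ,
          Conn-trans (subst (λ v → Conn (Class′ v) (pos w) (set pos a z w)) (φ-W p) (start w)) (Conn-trans (Conn-mono sub r)
            (Conn-sym (subst (λ v → Conn (Class′ v) (pos l) (set pos a z l)) eq (start l)))))

  size≡0⇒∉ : ∀ {Z e} X → size Z X ≡ 0 → e ∈ Z → e ∉ ∂ X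
  size≡0⇒∉ {Z} {e} X eq e∈ with ∈? (∂ X) e
  ... | inj₂ q = q
  ... | inj₁ q = contradiction (≤-trans (cnt-insert ∅ (Z ∩ ∂ X) e (λ ()) (∧-intro e∈ q) refl) (≤-reflexive eq)) (λ ())

  ∂-value : ∀ {e u v} X → Ends e u v → ∂ X e ≡ X u xor X v
  ∂-value X (inj₁ (refl , refl)) = refl
  ∂-value X (inj₂ (refl , refl)) = Bool.xor-comm (X _) (X _)

  -- A T-join argument: if no edge at the token a can be deleted, then deleting one isolates an odd set, hence every
  -- set it isolates is odd, and moving a along the deleted edge restores evenness.
  pairing : ∀ fuel Z A pos → cnt Z + cnt A < fuel → Even Z A pos → Paired Z A pos
  pairing (suc fuel) Z A pos lt even with any? (λ a → A a Bool.≟ true)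
  ... | no ¬a = record
    { W = ∅ ; W⊆A = λ () ; half = ≤-trans (cnt-mono A ∅ (λ {x} p → contradiction (x , p) ¬a)) (m≤m+n _ _)
    ; φ = id ; φ-W = λ () ; lab = λ _ → c ; link = λ () }
  ... | yes (a , a∈) with pos a ≟ c
  ... | yes pa≡c = paired-arrive a∈ pa≡c (pairing fuel Z (A ∖ a) pos
          (≤-trans (≤-reflexive (sym (+-suc (cnt Z) _))) (≤-trans (+-monoʳ-≤ (cnt Z)
            (cnt-insert (A ∖ a) A a (λ p → proj₁ (∖-⊆ A p)) a∈ (∖-∉ A a))) (s≤s⁻¹ lt)))
          (λ X c∉ q → trans (cong (_xor odd (A ∖ a) pos X) (sym (trans (cong X pa≡c) c∉)))
                        (trans (sym (odd-remove A pos a X a∈)) (even X c∉ q))))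
  ... | no pa≢c with any? (λ b → ((A ∖ a) b Bool.≟ true) ×-dec (pos a ≟ pos b))
  ... | yes (b , b∈ , pa≡pb) = paired-meet a∈ (proj₁ (∖-⊆ A b∈)) (proj₂ (∖-⊆ A b∈)) pa≡pb
          (pairing fuel Z (A ∖ a ∖ b) pos
            (≤-trans (≤-reflexive (sym (+-suc (cnt Z) _))) (≤-trans (+-monoʳ-≤ (cnt Z)
              (cnt-insert (A ∖ a ∖ b) A a (λ p → proj₁ (∖-⊆ A (proj₁ (∖-⊆ (A ∖ a) p)))) a∈
                (∧-falseˡ _ (∖-∉ A a)))) (s≤s⁻¹ lt)))
            (λ X c∉ q → trans (sym (cancel X)) (trans (sym (two-removed X)) (even X c∉ q))))
    where
    two-removed : ∀ X → odd A pos X ≡ X (pos a) xor (X (pos b) xor odd (A ∖ a ∖ b) pos X)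
    two-removed X = trans (odd-remove A pos a X a∈) (cong (X (pos a) xor_) (odd-remove (A ∖ a) pos b X b∈))
    cancel : ∀ X → X (pos a) xor (X (pos b) xor odd (A ∖ a ∖ b) pos X) ≡ odd (A ∖ a ∖ b) pos X
    cancel X rewrite pa≡pb = trans (sym (Bool.xor-assoc (X (pos b)) (X (pos b)) _))
      (cong (_xor odd (A ∖ a ∖ b) pos X) (Bool.xor-same (X (pos b))))
  ... | no alone with crossing? Z ⁅ pos a ⁆
  -- Without an edge of `Z` at it, the vertex `pos a` would be an isolated set with exactly one
  -- token.
  ... | inj₂ none = ∈∉ odd-y (even ⁅ pos a ⁆ (is-≢ pa≢c) (size≡0 {Z} ⁅ pos a ⁆ none))
    where
    odd-y : odd A pos ⁅ pos a ⁆ ≡ true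
    odd-y = trans (odd-remove A pos a ⁅ pos a ⁆ a∈)
      (cong₂ _xor_ (is-refl (pos a)) (trans (parity-cong (λ x → (A ∖ a) x ∧ is (pos a) (pos x)) ∅ empty) (parity-∅ {V})))
      where
      empty : ∀ b → (A ∖ a) b ∧ is (pos a) (pos b) ≡ false
      empty b with ∈? (A ∖ a) b
      ... | inj₁ p = trans (cong (_∧ _) p) (is-≢ (λ eq → alone (b , p , eq)))
      ... | inj₂ p = ∧-falseˡ _ p
  ... | inj₁ (e , e∈ , cr) with ∂⇒Ends ⁅ pos a ⁆ cr
  ... | u , z , j , u∈ , z∉ = result
    where
    y : Fin V
    y = pos a
    j′ : Ends e y z
    j′ = subst (λ u → Ends e u z) (sym (is-true u∈)) j
    fewer : cnt (Z ∖ e) + cnt A < fuel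
    fewer = ≤-trans (+-monoˡ-≤ (cnt A) (cnt-insert (Z ∖ e) Z e (λ p → proj₁ (∖-⊆ Z p)) e∈ (∖-∉ Z e))) (s≤s⁻¹ lt)
    closed : ∀ X → size (Z ∖ e) X ≡ 0 → e ∉ ∂ X → size Z X ≡ 0
    closed X q e∉ = size≡0 {Z} X lem
      where
      lem : ∀ {f} → f ∈ Z → f ∉ ∂ X
      lem {f} f∈ with e ≟ f
      ... | yes refl = e∉
      ... | no e≢f   = size≡0⇒∉ {Z ∖ e} X q (∖-∈ Z f∈ e≢f)
    Odd : BSet V → Set
    Odd X = c ∉ X × size (Z ∖ e) X ≡ 0 × odd A pos X ≡ true
    moved : ∀ X₀ → Odd X₀ → Even (Z ∖ e) A (set pos a z)
    moved X₀ (c∉₀ , q₀ , odd₀) X c∉ q with ∈? (∂ X) e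
    ... | inj₂ e∉ = trans (parity-cong _ _ agree) (even X c∉ (closed X q e∉))
      where
      agree : ∀ b → A b ∧ X (set pos a z b) ≡ A b ∧ X (pos b)
      agree b with a ≟ b
      ... | yes refl = cong (A a ∧_) (trans (cong X (set-same pos a z)) (sym (xor≡false (trans (sym (∂-value X j′)) e∉))))
      ... | no a≢b = cong (λ v → A b ∧ X v) (set-other pos a z a≢b)
    -- Both `X` and `X₀` are crossed by `e`, so their symmetric difference is isolated in `Z` itself
    -- and holds an even number of tokens. Hence `X` is odd like `X₀`, and moving `a` across its
    -- boundary makes it even.
    ... | inj₁ e∈∂ = xor-true odd-X (trans (parity-flip _ _ a agree)
            (trans (cong₂ (λ s t → (s ∧ X (set pos a z a)) xor (t ∧ X y)) a∈ a∈)
            (trans (cong (λ v → X v xor X y) (set-same pos a z))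
            (trans (Bool.xor-comm (X z) (X y)) (trans (sym (∂-value X j′)) e∈∂)))))
      where
      xor-true : ∀ {p q} → q ≡ true → p xor q ≡ true → p ≡ false
      xor-true {false} refl _ = refl
      agree : ∀ {b} → a ≢ b → A b ∧ X (set pos a z b) ≡ A b ∧ X (pos b)
      agree {b} a≢b = cong (λ v → A b ∧ X v) (set-other pos a z a≢b)
      _⊕_ : BSet V → BSet V → BSet V
      (P ⊕ Q) x = P x xor Q x
      e∈∂₀ : e ∈ ∂ X₀
      e∈∂₀ with ∈? (∂ X₀) e
      ... | inj₁ p = p
      ... | inj₂ p = ∈∉ odd₀ (even X₀ c∉₀ (closed X₀ q₀ p))
      ∂-⊕ : ∀ f → ∂ (X ⊕ X₀) f ≡ ∂ X f xor ∂ X₀ f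
      ∂-⊕ f = xor-interchange (X (src f)) (X₀ (src f)) (X (tgt f)) (X₀ (tgt f))
      closed-⊕ : size Z (X ⊕ X₀) ≡ 0
      closed-⊕ = closed (X ⊕ X₀)
        (size≡0 {Z ∖ e} (X ⊕ X₀) (λ {f} p → trans (∂-⊕ f) (cong₂ _xor_ (size≡0⇒∉ {Z ∖ e} X q p) (size≡0⇒∉ {Z ∖ e} X₀ q₀ p))))
        (trans (∂-⊕ e) (cong₂ _xor_ e∈∂ e∈∂₀))
      odd-X : odd A pos X ≡ true
      odd-X = trans (xor≡false (trans (sym (parity-xor (λ b → A b ∧ X (pos b)) (λ b → A b ∧ X₀ (pos b))))
        (trans (parity-cong _ _ (λ b → sym (Bool.∧-distribˡ-xor (A b) (X (pos b)) (X₀ (pos b)))))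
               (even (X ⊕ X₀) (cong₂ _xor_ c∉ c∉₀) closed-⊕)))) odd₀
    result : Paired Z A pos
    result with search (λ {P} {Q} eq (p , q , r) → trans (sym (eq c)) p , trans (sym (size-cong (Z ∖ e) eq)) q ,
                          trans (parity-cong _ _ (λ b → cong (A b ∧_) (sym (eq (pos b))))) r)
                       (λ X → (X c Bool.≟ false) ×-dec (size (Z ∖ e) X Nat.≟ 0) ×-dec (odd A pos X Bool.≟ true))
    ... | yes (X₀ , p) = paired-move e∈ j′ (pairing fuel (Z ∖ e) A (set pos a z) fewer (moved X₀ p))
    ... | no ¬p = paired-⊆ (λ p → proj₁ (∖-⊆ Z p)) (pairing fuel (Z ∖ e) A pos fewer even′)
      where
      even′ : Even (Z ∖ e) A pos
      even′ X c∉ q with odd A pos X in eq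
      ... | true  = contradiction (X , c∉ , q , eq) ¬p
      ... | false = refl

-- Leaves and hubs: no member of L is a hub, and the hubs are at most as many as the members of L.
-- If 3 |L| < |T|, then either some further element can join L, or the elements that are neither
-- in L nor hubs all point into L, and these are more than L.
select : {n : ℕ} (T : BSet n) (D : Fin n → Set) (R : Fin n → Fin n → Set) → (∀ {i h} → R i h → i ≢ h) →
         (∀ i → i ∈ T → D i ⊎ ∃ (R i)) →
         ∃ λ L → L ⊆ T × cnt T ≤ 3 * cnt L × (∀ i → i ∈ L → D i ⊎ ∃ λ h → h ∉ L × R i h)
select {n} T D R R-irr opt = go (suc (cnt T)) ∅ ∅ (λ ()) (λ ()) ≤-refl (λ _ ()) (m≤m+n _ _)
  where
  Goal : Set
  Goal = ∃ λ L → L ⊆ T × cnt T ≤ 3 * cnt L × (∀ i → i ∈ L → D i ⊎ ∃ λ h → h ∉ L × R i h)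
  go : ∀ fuel L H → L ⊆ T → (∀ {x} → x ∈ L → x ∉ H) → cnt H ≤ cnt L →
       (∀ i → i ∈ L → D i ⊎ ∃ λ h → h ∈ H × R i h) → cnt T < fuel + cnt L → Goal
  go zero L H L⊆T _ _ _ bound = contradiction (≤-trans bound (cnt-mono L T L⊆T)) (<-irrefl refl)
  go (suc fuel) L H L⊆T L∩H |H|≤|L| hub bound = proceed (choose dichotomy)
    where
    Rest : BSet n
    Rest = T ∩ ∁ L ∩ ∁ H
    rest : ∀ {r} → r ∈ Rest → r ∈ T × r ∉ L × r ∉ H
    rest p with ∩-elim (T ∩ ∁ L) (∁ H) p
    ... | q , r∉H with ∩-elim T (∁ L) q
    ... | r∈T , r∉L = r∈T , not-true r∉L , not-true r∉H
    Extra : Set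
    Extra = ∃ λ r → r ∈ Rest × (D r ⊎ ∃ λ h → h ∉ L × R r h)
    dichotomy : ∀ r → (r ∈ Rest → ∃ λ h → h ∈ L × R r h) ⊎ Extra
    dichotomy r with ∈? Rest r
    ... | inj₂ r∉ = inj₁ (λ r∈ → ∈∉ r∈ r∉)
    ... | inj₁ r∈ with opt r (proj₁ (rest r∈))
    ... | inj₁ Dr = inj₂ (r , r∈ , inj₁ Dr)
    ... | inj₂ (h , Rrh) with ∈? L h
    ... | inj₁ h∈ = inj₁ (λ _ → h , h∈ , Rrh)
    ... | inj₂ h∉ = inj₂ (r , r∈ , inj₂ (h , h∉ , Rrh))
    more : ∀ {L′} → suc (cnt L) ≤ cnt L′ → cnt T < fuel + cnt L′
    more p = ≤-trans bound (≤-trans (≤-reflexive (sym (+-suc fuel (cnt L)))) (+-monoʳ-≤ fuel p))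
    proceed : (∀ r → r ∈ Rest → ∃ λ h → h ∈ L × R r h) ⊎ Extra → Goal
    proceed (inj₂ (r , r∈ , o)) = add o
      where
      L′ = L ∪ ⁅ r ⁆
      r∉L = proj₁ (proj₂ (rest r∈))
      r∉H = proj₂ (proj₂ (rest r∈))
      bigger : suc (cnt L) ≤ cnt L′
      bigger = cnt-insert L L′ r ∨-introˡ (∨-introʳ (L r) (is-refl r)) r∉L
      L′⊆T : L′ ⊆ T
      L′⊆T p with ∪-elim L ⁅ r ⁆ p
      ... | inj₁ q = L⊆T q
      ... | inj₂ q = subst (_∈ T) (is-true q) (proj₁ (rest r∈))
      add : (D r ⊎ ∃ λ h → h ∉ L × R r h) → Goal
      add (inj₁ Dr) = go fuel L′ H L′⊆T disj (≤-trans |H|≤|L| (<⇒≤ bigger)) hub′ (more {L′} bigger)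
        where
        disj : ∀ {x} → x ∈ L′ → x ∉ H
        disj p with ∪-elim L ⁅ r ⁆ p
        ... | inj₁ q = L∩H q
        ... | inj₂ q = subst (_∉ H) (is-true q) r∉H
        hub′ : ∀ i → i ∈ L′ → D i ⊎ ∃ λ h → h ∈ H × R i h
        hub′ i p with ∪-elim L ⁅ r ⁆ p
        ... | inj₁ q = hub i q
        ... | inj₂ q = inj₁ (subst D (is-true q) Dr)
      add (inj₂ (h , h∉ , Rrh)) = go fuel L′ H′ L′⊆T disj
          (≤-trans (cnt-cover H′ H h cover) (≤-trans (s≤s |H|≤|L|) bigger)) hub′ (more {L′} bigger)
        where
        H′ = H ∪ ⁅ h ⁆
        cover : ∀ {x} → x ∈ H′ → h ≢ x → x ∈ H
        cover p h≢x with ∪-elim H ⁅ h ⁆ p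
        ... | inj₁ q = q
        ... | inj₂ q = contradiction (is-true q) h≢x
        disj : ∀ {x} → x ∈ L′ → x ∉ H′
        disj p with ∪-elim L ⁅ r ⁆ p
        ... | inj₁ q = ∨-false (L∩H q) (is-≢ (λ { refl → ∈∉ q h∉ }))
        ... | inj₂ q = subst (_∉ H′) (is-true q) (∨-false r∉H (is-≢ (λ eq → R-irr Rrh (sym eq))))
        hub′ : ∀ i → i ∈ L′ → D i ⊎ ∃ λ h → h ∈ H′ × R i h
        hub′ i p with ∪-elim L ⁅ r ⁆ p
        ... | inj₂ q = inj₂ (h , ∨-introʳ (H h) (is-refl h) , subst (λ i → R i h) (is-true q) Rrh)
        ... | inj₁ q with hub i q
        ... | inj₁ Di = inj₁ Di
        ... | inj₂ (g , g∈ , Rig) = inj₂ (g , ∨-introˡ g∈ , Rig)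
    proceed (inj₁ into) with cnt Rest ≤? cnt L
    -- The roles change: `Rest` becomes the set of leaves and the old leaves `L` become its hubs.
    -- Progress is measured by the number of leaves alone.
    ... | no more-rest = go fuel Rest L (λ p → proj₁ (rest p)) (λ p → proj₁ (proj₂ (rest p)))
            (<⇒≤ (≰⇒> more-rest)) (λ i p → inj₂ (into i p)) (more {Rest} (≰⇒> more-rest))
    ... | yes few = L , L⊆T , bound′ , hub′
      where
      -- `T` is covered by `L`, `H` and `Rest`, none of which has more elements than `L`.
      bound′ : cnt T ≤ 3 * cnt L
      bound′ = begin
        cnt T                       ≤⟨ cnt-mono T (L ∪ (H ∪ Rest)) covered ⟩
        cnt (L ∪ (H ∪ Rest))        ≤⟨ cnt-∪ L (H ∪ Rest) ⟩
        cnt L + cnt (H ∪ Rest)      ≤⟨ +-monoʳ-≤ (cnt L) (cnt-∪ H Rest) ⟩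
        cnt L + (cnt H + cnt Rest)  ≤⟨ +-monoʳ-≤ (cnt L) (+-mono-≤ |H|≤|L| few) ⟩
        cnt L + (cnt L + cnt L)     ≡⟨ cong (λ k → cnt L + (cnt L + k)) (sym (+-identityʳ _)) ⟩
        3 * cnt L                   ∎
        where
        open ≤-Reasoning
        covered : T ⊆ L ∪ (H ∪ Rest)
        covered {x} p with ∈? L x | ∈? H x
        ... | inj₁ q | _      = ∨-introˡ q
        ... | inj₂ q | inj₁ r = ∨-introʳ (L x) (∨-introˡ r)
        ... | inj₂ q | inj₂ r = ∨-introʳ (L x) (∨-introʳ (H x) (∧-intro (∧-intro p (not-intro q)) (not-intro r)))
      hub′ : ∀ i → i ∈ L → D i ⊎ ∃ λ h → h ∉ L × R i h
      hub′ i p with hub i p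
      ... | inj₁ Di = inj₁ Di
      ... | inj₂ (h , h∈ , Rih) = inj₂ (h , h∉ , Rih)
        where
        h∉ : h ∉ L
        h∉ with ∈? L h
        ... | inj₁ q = ∈∉ h∈ (L∩H q)
        ... | inj₂ q = q

-- Ownership of edges, and the step from level `j` to level `suc j`

module Levels {V E : ℕ} (src tgt : Fin E → Fin V) (c : Fin V) where
  open Cuts src tgt
  open Pairing src tgt c

  Ownership : Set
  Ownership = Fin E → Fin V

  -- The set Z_v of the opening comment.
  owned : Ownership → Fin V → BSet E
  owned own v e = is (own e) v

  -- An edge whose owner lies outside T is free.
  record State (j : ℕ) (T : BSet V) (own : Ownership) : Set where
    field
      c∉T     : c ∉ T
      cut     : ∀ {v} → v ∈ T → ∀ X → v ∈ X → c ∉ X → j ≤ size (owned own v) X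
      private-ends : ∀ {e w} → own e ∈ T → w ∈ T → Inc e w → w ≡ own e

    reach : 1 ≤ j → ∀ {v} → v ∈ T → Conn (owned own v) v c
    reach 1≤j v∈ X v∈X c∉X = size≥1⇒cross {owned own _} X (≤-trans 1≤j (cut v∈ X v∈X c∉X))

  -- Membership of `p` in the least set Y_i, phrased through all deficient sets. It holds vacuously
  -- for every `p` once no set is deficient.
  Tight : ℕ → Ownership → Fin V → Fin V → Set
  Tight j own i p = ∀ X → i ∈ X → c ∉ X → size (owned own i) X ≤ j → p ∈ X

  -- By `away` no set isolated in `Hub` that avoids `c` contains a token, so the tokens can be
  -- paired along hub edges. By `home` the edges of a terminal that is given up continue a
  -- connection from its token to `c`.
  module Advance {j L own} (st : State j L own) (Hub : BSet E)
    (hub-free : ∀ {e} → e ∈ Hub → own e ∉ L) (hub-avoids : ∀ {e w} → e ∈ Hub → Inc e w → w ∉ L)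
    (pos : Fin V → Fin V) (tight : ∀ {i} → i ∈ L → Tight j own i (pos i))
    (home : ∀ {i} → i ∈ L → Conn (owned own i) (pos i) c) (away : ∀ {i} → i ∈ L → Conn Hub (pos i) c) where

    open State st

    paired : Paired Hub L pos
    paired = pairing (suc (cnt Hub + cnt L)) Hub L pos ≤-refl even
      where
      even : Even Hub L pos
      even X c∉ q = trans (parity-cong (λ i → L i ∧ X (pos i)) ∅ none) (parity-∅ {V})
        where
        none : ∀ i → L i ∧ X (pos i) ≡ false
        none i with ∈? L i | ∈? X (pos i)
        ... | inj₂ i∉ | _       = ∧-falseˡ _ i∉
        ... | inj₁ _  | inj₂ p∉ = ∧-falseʳ (L i) p∉
        ... | inj₁ i∈ | inj₁ p∈ with away i∈ X p∈ c∉
        ... | e , e∈ , cr = ∈∉ cr (size≡0⇒∉ {Hub} X q e∈)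

    open Paired paired

    -- The edges of a terminal that is given up pass to its partner in `W`, and hub edges follow the
    -- labels of the pairing. The value `c` means that an edge is free.
    own′ : Ownership
    own′ e = if L (own e) then φ (own e) else (if Hub e then lab e else c)

    own′-L : ∀ {e} → own e ∈ L → own′ e ≡ φ (own e)
    own′-L p rewrite p = refl

    own′-hub : ∀ {e} → e ∈ Hub → own′ e ≡ lab e
    own′-hub p rewrite hub-free p | p = refl

    private-ends′ : ∀ {e w} → own′ e ∈ W → w ∈ W → Inc e w → w ≡ own′ e
    private-ends′ {e} {w} p w∈ inc with ∈? L (own e) | ∈? Hub e
    -- An end `w` in `W` is the old owner of the edge, and `φ` fixes it; so inherited edges touch no
    -- member of `W`.
    ... | inj₁ q | _ = trans (sym (φ-W w∈)) (trans (cong φ (private-ends q (W⊆A w∈) inc)) (sym (own′-L q)))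
    ... | inj₂ _ | inj₁ h = ∈∉ (W⊆A w∈) (hub-avoids h inc)
    ... | inj₂ q | inj₂ h rewrite q | h = ∈∉ (W⊆A p) c∉T

    grows : ∀ {w} → w ∈ W → owned own w ⊆ owned own′ w
    grows w∈ p with refl ← is-true p = is-≡ (trans (own′-L (W⊆A w∈)) (φ-W w∈))

    -- A set `X` that only `j` old edges leave contains `pos w` by tightness. The connection from
    -- there to `c`, along hub edges and possibly on along the edges of the partner, leaves `X` by
    -- an edge that `w` did not own before.
    cut′ : ∀ {w} → w ∈ W → ∀ X → w ∈ X → c ∉ X → suc j ≤ size (owned own′ w) X
    cut′ {w} w∈ X w∈X c∉X with suc j ≤? size (owned own w) X
    ... | yes p = ≤-trans p (size-mono {owned own w} {owned own′ w} X (grows w∈))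
    ... | no ¬p = gain (tight (W⊆A w∈) X w∈X c∉X (≮⇒≥ ¬p))
      where
      new : ∀ {e} → e ∈ ∂ X → own′ e ≡ w → own e ≢ w → suc j ≤ size (owned own′ w) X
      new {e} cr eq neq = ≤-trans (s≤s (cut (W⊆A w∈) X w∈X c∉X))
        (cnt-insert (owned own w ∩ ∂ X) (owned own′ w ∩ ∂ X) e
          (λ p → ∧-intro (grows w∈ (proj₁ (∧-elim p))) (proj₂ (∧-elim p))) (∧-intro (is-≡ eq) cr) (∧-falseˡ _ (is-≢ neq)))
      via-hub : ∀ {x} → Conn (Class w) (pos w) x → pos w ∈ X → x ∉ X → suc j ≤ size (owned own′ w) X
      via-hub con p∈ x∉ with con X p∈ x∉
      ... | e , e∈ , cr = new cr (trans (own′-hub (proj₁ (∧-elim e∈))) (is-true (proj₂ (∧-elim e∈))))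
              (λ { refl → ∈∉ (W⊆A w∈) (hub-free (proj₁ (∧-elim e∈))) })
      gain : pos w ∈ X → suc j ≤ size (owned own′ w) X
      gain p∈ with link w∈
      ... | inj₁ con = via-hub con p∈ c∉X
      ... | inj₂ (l , l∈ , l∉W , eq , con) with ∈? X (pos l)
      ... | inj₂ l∉ = via-hub con p∈ l∉
      ... | inj₁ l∈X with home l∈ X l∈X c∉X
      ... | e , e∈ , cr = new cr (trans (own′-L (subst (_∈ L) (sym (is-true e∈)) l∈)) (trans (cong φ (is-true e∈)) eq))
              (λ own≡w → ∈∉ w∈ (subst (_∉ W) (trans (sym (is-true e∈)) own≡w) l∉W))

    advance : ∃ λ W → ∃ λ own′ → W ⊆ L × cnt L ≤ 2 * cnt W × State (suc j) W own′
    advance = W , own′ , W⊆A , half , record { c∉T = c∉W ; cut = cut′ ; private-ends = private-ends′ }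
      where
      c∉W : c ∉ W
      c∉W with ∈? W c
      ... | inj₁ p = ∈∉ (W⊆A p) c∉T
      ... | inj₂ p = p

-- Enlarging the owned sets until terminals meet, and iterating the levels

module Growth {V E : ℕ} (src tgt : Fin E → Fin V) (c : Fin V) where
  open Cuts src tgt
  open Levels src tgt c

  -- Guarantees that from any vertex where the edges of a hub are met, these edges lead on to `c`.
  Rooted : BSet V → Ownership → Set
  Rooted T own = ∀ {e x} → own e ∈ T → Inc e x → Conn (owned own (own e)) x c

  -- Frees the edges of each terminal outside the component `K` of `c`. Cuts survive because the
  -- owned edges that leave `X ∩ K` lie in the component and leave `X` too.
  prune : ∀ {j T own} → 1 ≤ j → State j T own → ∃ λ own′ → State j T own′ × Rooted T own′
  prune {j} {T} {own} 1≤j st = own′ , record { c∉T = c∉T ; cut = cut′ ; private-ends = private-ends′ } , rooted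
    where
    open State st
    module C v = Component (component (owned own v) c)
    own′ : Ownership
    own′ e = if T (own e) ∧ C.K (own e) (src e) then own e else c
    kept : ∀ {e v} → v ∈ T → e ∈ C.Inside v → own′ e ≡ v
    kept v∈ p with ∧-elim p
    ... | q , r with refl ← is-true q rewrite ∧-intro v∈ r = refl
    keep-or-drop : ∀ e → (own′ e ≡ own e × C.K (own e) (src e) ≡ true) ⊎ own′ e ≡ c
    keep-or-drop e with T (own e) | C.K (own e) (src e)
    ... | true  | true  = inj₁ (refl , refl)
    ... | true  | false = inj₂ refl
    ... | false | _     = inj₂ refl
    private-ends′ : ∀ {e w} → own′ e ∈ T → w ∈ T → Inc e w → w ≡ own′ e
    private-ends′ {e} p w∈ inc with keep-or-drop e
    ... | inj₁ (q , _) = trans (private-ends (subst (_∈ T) q p) w∈ inc) (sym q)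
    ... | inj₂ q = ∈∉ (subst (_∈ T) q p) c∉T
    cut′ : ∀ {v} → v ∈ T → ∀ X → v ∈ X → c ∉ X → j ≤ size (owned own′ v) X
    cut′ {v} v∈ X v∈X c∉X = ≤-trans
      (cut v∈ (X ∩ K) (∧-intro v∈X (C.Conn⇒∈ v (reach 1≤j v∈))) (∧-falseˡ (K c) c∉X))
      (cnt-mono (owned own v ∩ ∂ (X ∩ K)) (owned own′ v ∩ ∂ X) sub)
      where
      K = C.K v
      sub : owned own v ∩ ∂ (X ∩ K) ⊆ owned own′ v ∩ ∂ X
      sub {e} p with ∧-elim p
      ... | e∈ , cr with ∂⇒Ends (X ∩ K) cr
      ... | u , z , j , u∈ , z∉ with ∩-elim X K u∈ | ∧-false z∉
      ... | u∈X , u∈K | inj₂ z∉K = ∈∉ (C.closed v e∈ j u∈K) z∉K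
      ... | u∈X , u∈K | inj₁ z∉X = ∧-intro (is-≡ (kept v∈ (C.inside v e∈ j u∈K))) (∂-Ends X j u∈X z∉X)
    rooted : Rooted T own′
    rooted {e} {x} p inc with keep-or-drop e
    ... | inj₂ q = ∈∉ (subst (_∈ T) q p) c∉T
    ... | inj₁ (q , s∈) rewrite q = Conn-mono (λ r → is-≡ (kept p r)) (C.∈⇒Conn (own e) (end-in inc))
      where
      end-in : Inc e x → x ∈ C.K (own e)
      end-in (inj₁ refl) = s∈
      end-in (inj₂ refl) = C.closed (own e) (is-refl (own e)) (inj₁ (refl , refl)) s∈

  -- The outcomes when the least tight set of `i` yields no edge to give away: no cut is deficient,
  -- the set contains a vertex from which another terminal's edges lead to `c`, or a free edge joins
  -- `i` to another terminal.
  data Contact (j : ℕ) (T : BSet V) (own : Ownership) (i : Fin V) : Set where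
    none  : (∀ X → i ∈ X → c ∉ X → suc j ≤ size (owned own i) X) → Contact j T own i
    touch : ∀ {p h} → h ∈ T → h ≢ i → Tight j own i p → Conn (owned own i) p c → Conn (owned own h) p c → Contact j T own i
    link  : ∀ {e h} → h ∈ T → h ≢ i → Ends e i h → own e ∉ T → Contact j T own i

  -- The field `only-v` preserves `private-ends` when `v` receives the edge, and `near` preserves
  -- `Rooted`.
  record Gift (T : BSet V) (own : Ownership) : Set where
    field
      {e}     : Fin E
      {v x z} : Fin V
      free    : own e ∉ T
      v∈T     : v ∈ T
      ends    : Ends e x z
      only-v  : ∀ {w} → w ∈ T → Inc e w → w ≡ v
      near    : Conn (owned own v) x c

  give : ∀ {j T own} → State j T own → Rooted T own → (g : Gift T own) →
         let open Gift g in State j T (set own e v) × Rooted T (set own e v)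
  give {j} {T} {own} st rooted g = record { c∉T = c∉T ; cut = cut′ ; private-ends = private-ends′ } , rooted′
    where
    open State st
    open Gift g
    own′ = set own e v
    grows : ∀ {w} → w ∈ T → owned own w ⊆ owned own′ w
    grows w∈ {f} p with e ≟ f
    ... | yes refl = ∈∉ (subst (_∈ T) (sym (is-true p)) w∈) free
    ... | no e≢f = is-≡ (trans (set-other own e v e≢f) (is-true p))
    cut′ : ∀ {w} → w ∈ T → ∀ X → w ∈ X → c ∉ X → j ≤ size (owned own′ w) X
    cut′ {w} w∈ X w∈X c∉X = ≤-trans (cut w∈ X w∈X c∉X) (size-mono {owned own w} {owned own′ w} X (grows w∈))
    private-ends′ : ∀ {f w} → own′ f ∈ T → w ∈ T → Inc f w → w ≡ own′ f
    private-ends′ {f} p w∈ inc with e ≟ f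
    ... | yes refl = trans (only-v w∈ inc) (sym (set-same own e v))
    ... | no e≢f = trans (private-ends (subst (_∈ T) (set-other own e v e≢f) p) w∈ inc) (sym (set-other own e v e≢f))
    near′ : ∀ {y} → Inc e y → Conn (owned own′ v) y c
    near′ inc with Ends⇒Inc ends inc
    ... | inj₁ refl = Conn-mono (grows v∈T) near
    ... | inj₂ refl = Conn-trans (Conn-edge (is-≡ (set-same own e v)) (Ends-sym ends)) (Conn-mono (grows v∈T) near)
    rooted′ : Rooted T own′
    rooted′ {f} {y} p inc with e ≟ f
    ... | yes refl = subst (λ w → Conn (owned own′ w) y c) (sym (set-same own e v)) (near′ inc)
    ... | no e≢f with set-other own e v e≢f
    ... | eq = subst (λ w → Conn (owned own′ w) y c) (sym eq)
                 (Conn-mono (grows (subst (_∈ T) eq p)) (rooted (subst (_∈ T) eq p) inc))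

  module _ {j : ℕ} {T : BSet V} (1≤j : 1 ≤ j)
    (connectivity : ∀ {v} → v ∈ T → ∀ X → v ∈ X → c ∉ X → suc j ≤ cnt (∂ X)) where

    private
      module TightSets {own} (st : State j T own) {i} (i∈T : i ∈ T) where
        Member : BSet V → Set
        Member X = i ∈ X × c ∉ X × size (owned own i) X ≤ j

        member-resp : ∀ {A B} → A ≗ B → Member A → Member B
        member-resp eq (p , q , r) =
          trans (sym (eq i)) p , trans (sym (eq c)) q , subst (_≤ j) (size-cong (owned own i) eq) r

        member? : ∀ X → Dec (Member X)
        member? X = (X i Bool.≟ true) ×-dec ((X c Bool.≟ false) ×-dec (size (owned own i) X ≤? j))

        -- The union also separates `i` from `c` and is thus left by at least `j` owned edges;
        -- submodularity leaves at most `j` for the intersection.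
        member-∩ : ∀ {A B} → Member A → Member B → Member (A ∩ B)
        member-∩ {A} {B} (p , q , r) (p′ , q′ , r′) = ∧-intro p p′ , ∧-falseˡ _ q , +-cancelʳ-≤ j _ _
          (≤-trans (+-monoʳ-≤ (size (owned own i) (A ∩ B)) (State.cut st i∈T (A ∪ B) (∨-introˡ p) (∨-false q q′)))
          (≤-trans (submodular (owned own i) A B) (+-mono-≤ r r′)))

    contact-or-gift : ∀ {own} → State j T own → Rooted T own → ∀ i → i ∈ T → Contact j T own i ⊎ Gift T own
    contact-or-gift {own} st rooted i i∈T
        with search (TightSets.member-resp st i∈T) (TightSets.member? st i∈T)
    ... | no ¬p = inj₁ (none (λ X i∈ c∉ → ≰⇒> (λ q → ¬p (X , i∈ , c∉ , q))))
    ... | yes (X₀ , p₀)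
        with least (TightSets.member-resp st i∈T) (TightSets.member? st i∈T) (TightSets.member-∩ st i∈T) X₀ p₀
    ... | Y , (i∈Y , c∉Y , dY) , min
        with cnt-gap (owned own i ∩ ∂ Y) (∂ Y) (≤-trans (s≤s dY) (connectivity i∈T Y i∈Y c∉Y))
    ... | e , cr , e∉ with ∂⇒Ends Y cr
    ... | y , z , ends , y∈Y , z∉Y = result
      where
      open State st
      own≢i : own e ≢ i
      own≢i eq = ∈∉ (∧-intro (is-≡ eq) cr) e∉
      tight : Tight j own i y
      tight X i∈ c∉ q = min X (i∈ , c∉ , q) y∈Y
      -- Otherwise some set `X` with `y` and without `c` is isolated in the edges of `i`. It misses
      -- `i` because `j` is positive, so removing it from `Y` gives a smaller tight set.
      near : Conn (owned own i) y c
      near X y∈X c∉X with crossing? (owned own i) X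
      ... | inj₁ r = r
      ... | inj₂ isolated = ∈∉ y∈X (not-true (proj₂ (∩-elim Y (∁ X)
              (min (Y ∩ ∁ X) (∧-intro i∈Y (not-intro i∉X) , ∧-falseˡ _ c∉Y , le) y∈Y))))
        where
        d0 : size (owned own i) X ≡ 0
        d0 = size≡0 {owned own i} X isolated
        i∉X : i ∉ X
        i∉X with ∈? X i
        ... | inj₂ q = q
        ... | inj₁ q = contradiction (≤-trans 1≤j (≤-trans (cut i∈T X q c∉X) (≤-reflexive d0))) (λ ())
        le : size (owned own i) (Y ∩ ∁ X) ≤ j
        le = begin
          size (owned own i) (Y ∩ ∁ X)                                 ≤⟨ m≤m+n _ _ ⟩
          size (owned own i) (Y ∩ ∁ X) + size (owned own i) (Y ∪ ∁ X)  ≤⟨ submodular (owned own i) Y (∁ X) ⟩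
          size (owned own i) Y + size (owned own i) (∁ X)              ≤⟨ +-mono-≤ dY (≤-reflexive (trans (size-∁ (owned own i) X) d0)) ⟩
          j + 0                                                        ≡⟨ +-identityʳ j ⟩
          j                                                            ∎
          where open ≤-Reasoning
      result : Contact j T own i ⊎ Gift T own
      result with ∈? T (own e)
      ... | inj₁ h∈ = inj₁ (touch h∈ own≢i tight near (rooted h∈ (Ends⇒Incˡ ends)))
      ... | inj₂ free with ∈? T y | ∈? T z
      ... | inj₂ y∉T | inj₂ z∉T = inj₂ (record { free = free ; v∈T = i∈T ; ends = ends ; near = near
              ; only-v = λ w∈ inc → [ (λ { refl → ∈∉ w∈ y∉T }) , (λ { refl → ∈∉ w∈ z∉T }) ]′ (Ends⇒Inc ends inc) })
      -- The outer end is a terminal, so the edge must not go to `i`; it is given to `z` instead.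
      ... | inj₂ y∉T | inj₁ z∈T = inj₂ (record { free = free ; v∈T = z∈T ; ends = Ends-sym ends ; near = reach 1≤j z∈T
              ; only-v = λ w∈ inc → [ (λ { refl → ∈∉ w∈ y∉T }) , id ]′ (Ends⇒Inc ends inc) })
      ... | inj₁ y∈T | _ with y ≟ i
      -- A second terminal inside the least tight set serves as the hub, met at its own vertex.
      ... | no y≢i = inj₁ (touch y∈T y≢i tight near (reach 1≤j y∈T))
      result | inj₂ free | inj₁ y∈T | inj₁ z∈T | yes refl = inj₁ (link z∈T (λ { refl → ∈∉ i∈Y z∉Y }) ends free)
      result | inj₂ free | inj₁ y∈T | inj₂ z∉T | yes refl = inj₂ (record { free = free ; v∈T = i∈T ; ends = ends ; near = near
              ; only-v = λ w∈ inc → [ id , (λ { refl → ∈∉ w∈ z∉T }) ]′ (Ends⇒Inc ends inc) })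

    -- Each gift lowers the number of free edges, so gifts come to an end.
    saturate : ∀ {own} → State j T own → Rooted T own →
               ∃ λ own′ → State j T own′ × (∀ i → i ∈ T → Contact j T own′ i)
    saturate {own} st rooted = go (suc (cnt (∁ T ∘ own))) own st rooted ≤-refl
      where
      go : ∀ fuel own → State j T own → Rooted T own → cnt (∁ T ∘ own) < fuel →
           ∃ λ own′ → State j T own′ × (∀ i → i ∈ T → Contact j T own′ i)
      go (suc fuel) own st rooted lt with choose dichotomy
        where
        dichotomy : ∀ i → (i ∈ T → Contact j T own i) ⊎ Gift T own
        dichotomy i with ∈? T i
        ... | inj₂ i∉ = inj₁ (λ i∈ → ∈∉ i∈ i∉)
        ... | inj₁ i∈ with contact-or-gift st rooted i i∈
        ... | inj₁ con = inj₁ (λ _ → con)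
        ... | inj₂ g = inj₂ g
      ... | inj₁ con = own , st , con
      ... | inj₂ g = go fuel (set own e v) (proj₁ (give st rooted g)) (proj₂ (give st rooted g)) (≤-trans fewer (s≤s⁻¹ lt))
        where
        open Gift g
        fewer : suc (cnt (∁ T ∘ set own e v)) ≤ cnt (∁ T ∘ own)
        fewer = cnt-insert (∁ T ∘ set own e v) (∁ T ∘ own) e sub (not-intro free)
                  (trans (cong (not ∘ T) (set-same own e v)) (cong not v∈T))
          where
          sub : ∁ T ∘ set own e v ⊆ ∁ T ∘ own
          sub {f} p with e ≟ f
          ... | yes refl = not-intro free
          ... | no e≢f = trans (sym (cong (not ∘ T) (set-other own e v e≢f))) p

    module _ {own : Ownership} (st : State j T own) (contact : ∀ i → i ∈ T → Contact j T own i) where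
      open State st

      private
        Done : Fin V → Set
        Done i = ∀ X → i ∈ X → c ∉ X → suc j ≤ size (owned own i) X

        Touches : Fin V → Fin V → Set
        Touches i h = ∃ λ p → Tight j own i p × Conn (owned own i) p c × Conn (owned own h) p c

        HasHub : Fin V → Fin V → Set
        HasHub i h = i ≢ h × h ∈ T × (Touches i h ⊎ ∃ λ e → Ends e i h × own e ∉ T)

        options : ∀ i → i ∈ T → Done i ⊎ ∃ (HasHub i)
        options i i∈ with contact i i∈
        ... | none p = inj₁ p
        ... | touch {p} {h} h∈ h≢ q r s = inj₂ (h , h≢ ∘ sym , h∈ , inj₁ (p , q , r , s))
        ... | link {e} {h} h∈ h≢ q r = inj₂ (h , h≢ ∘ sym , h∈ , inj₂ (e , q , r))

      -- The factor 6 is 3 for selecting leaves whose hubs are not selected, times 2 for pairing the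
      -- tokens of these leaves.
      raise : ∃ λ W → ∃ λ own′ → W ⊆ T × cnt T ≤ 6 * cnt W × State (suc j) W own′
      raise with select T Done HasHub proj₁ options
      ... | L , L⊆T , T≤3L , hubs = let W , own′ , W⊆L , L≤2W , st′ = advanced in
              W , own′ , (λ p → L⊆T (W⊆L p)) ,
              ≤-trans T≤3L (≤-trans (*-monoʳ-≤ 3 L≤2W) (≤-reflexive (sym (*-assoc 3 2 (cnt W))))) , st′
        where
        -- Edges with exactly one end in L go to that end, so that a linking edge leads its leaf to the hub.
        own₂ : Ownership
        own₂ e = if L (own e) then own e else
                 (if L (src e) ∧ not (L (tgt e)) then src e else
                 (if L (tgt e) ∧ not (L (src e)) then tgt e else c))
        own₂-L : ∀ {e} → own e ∈ L → own₂ e ≡ own e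
        own₂-L p rewrite p = refl
        own₂-link : ∀ {e i h} → own e ∉ L → Ends e i h → i ∈ L → h ∉ L → own₂ e ≡ i
        own₂-link p (inj₁ (refl , refl)) i∈ h∉ rewrite p | i∈ | h∉ = refl
        own₂-link p (inj₂ (refl , refl)) i∈ h∉ rewrite p | i∈ | h∉ = refl
        own₂-avoid : ∀ {e} → own e ∉ L → src e ∉ L → tgt e ∉ L → own₂ e ≡ c
        own₂-avoid p q r rewrite p | q | r = refl
        c∉L : c ∉ L
        c∉L with ∈? L c
        ... | inj₁ p = ∈∉ (L⊆T p) c∉T
        ... | inj₂ p = p
        private₂ : ∀ {e w} → own₂ e ∈ L → w ∈ L → Inc e w → w ≡ own₂ e
        private₂ {e} p w∈ inc with ∈? L (own e)
        ... | inj₁ q = trans (private-ends (L⊆T q) (L⊆T w∈) inc) (sym (own₂-L q))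
        ... | inj₂ q with ∈? L (src e) | ∈? L (tgt e)
        ... | inj₂ s | inj₂ t = ∈∉ p (trans (cong L (own₂-avoid q s t)) c∉L)
        private₂ {e} p w∈ (inj₁ refl) | inj₂ q | inj₁ s | inj₂ t = sym (own₂-link q (inj₁ (refl , refl)) s t)
        private₂ {e} p w∈ (inj₂ refl) | inj₂ q | inj₁ s | inj₂ t = ∈∉ w∈ t
        private₂ {e} p w∈ (inj₁ refl) | inj₂ q | inj₂ s | inj₁ t = ∈∉ w∈ s
        private₂ {e} p w∈ (inj₂ refl) | inj₂ q | inj₂ s | inj₁ t = sym (own₂-link q (inj₂ (refl , refl)) t s)
        private₂ {e} p w∈ inc | inj₂ q | inj₁ s | inj₁ t = ∈∉ p (trans (cong L own₂≡c) c∉L)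
          where
          own₂≡c : own₂ e ≡ c
          own₂≡c rewrite q | s | t = refl
        grows : ∀ {i} → i ∈ L → owned own i ⊆ owned own₂ i
        grows i∈ p with refl ← is-true p = is-≡ (own₂-L i∈)
        st₂ : State j L own₂
        st₂ = record
          { c∉T = c∉L
          ; cut = λ {i} i∈ X i∈X c∉X → ≤-trans (cut (L⊆T i∈) X i∈X c∉X) (size-mono {owned own i} {owned own₂ i} X (grows i∈))
          ; private-ends = private₂ }
        -- Every edge that neither belongs to a leaf nor touches one; by `owned⊆Hub` this includes
        -- all edges of the unselected terminals.
        Hub : BSet E
        Hub e = (∁ L (own₂ e) ∧ ∁ L (src e)) ∧ ∁ L (tgt e)
        hub-parts : ∀ {e} → e ∈ Hub → own₂ e ∉ L × src e ∉ L × tgt e ∉ L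
        hub-parts {e} p with ∩-elim (λ e → ∁ L (own₂ e) ∧ ∁ L (src e)) (∁ L ∘ tgt) p
        ... | q , t with ∩-elim (∁ L ∘ own₂) (∁ L ∘ src) {e} q
        ... | o , s = not-true o , not-true s , not-true t
        hub-avoids : ∀ {e w} → e ∈ Hub → Inc e w → w ∉ L
        hub-avoids {e} p (inj₁ refl) = proj₁ (proj₂ (hub-parts {e} p))
        hub-avoids {e} p (inj₂ refl) = proj₂ (proj₂ (hub-parts {e} p))
        owned⊆Hub : ∀ {h} → h ∈ T → h ∉ L → owned own h ⊆ Hub
        owned⊆Hub {h} h∈T h∉L {e} p with refl ← is-true p =
          ∧-intro (∧-intro (not-intro (trans (cong L (own₂-avoid h∉L (avoid (inj₁ refl)) (avoid (inj₂ refl)))) c∉L))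
            (not-intro (avoid (inj₁ refl)))) (not-intro (avoid (inj₂ refl)))
          where
          avoid : ∀ {w} → Inc e w → w ∉ L
          avoid {w} inc with ∈? L w
          ... | inj₂ q = q
          ... | inj₁ q = ∈∉ q (subst (_∉ L) (sym (private-ends h∈T (L⊆T q) inc)) h∉L)
        Token : Fin V → Fin V → Set
        Token i p = Tight j own₂ i p × Conn (owned own₂ i) p c × Conn Hub p c
        token : ∀ i → i ∈ L → ∃ (Token i)
        token i i∈ with hubs i i∈
        -- Without deficient cuts the token may start at `c`: tightness is vacuous and both
        -- connections are empty.
        ... | inj₁ done = c , (λ X i∈X c∉X q → contradiction
                  (≤-trans (done X i∈X c∉X) (≤-trans (size-mono {owned own i} {owned own₂ i} X (grows i∈)) q)) (<-irrefl refl))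
                , Conn-refl , Conn-refl
        ... | inj₂ (h , h∉L , _ , h∈T , inj₁ (p , t , r , s)) = p ,
                (λ X i∈X c∉X q → t X i∈X c∉X (≤-trans (size-mono {owned own i} {owned own₂ i} X (grows i∈)) q)) ,
                Conn-mono (grows i∈) r , Conn-mono (owned⊆Hub h∈T h∉L) s
        -- The token lies at the hub itself. A set with `i` but without `h` and `c` is left by the
        -- linking edge besides `j` edges owned before, hence is not deficient.
        ... | inj₂ (h , h∉L , _ , h∈T , inj₂ (e , ends , free)) = h , tight-h ,
                Conn-trans (Conn-edge (is-≡ own₂e) (Ends-sym ends)) (State.reach st₂ 1≤j i∈) ,
                Conn-mono (owned⊆Hub h∈T h∉L) (reach 1≤j h∈T)
          where
          free-L : own e ∉ L
          free-L with ∈? L (own e)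
          ... | inj₁ p = ∈∉ (L⊆T p) free
          ... | inj₂ p = p
          own₂e : own₂ e ≡ i
          own₂e = own₂-link free-L ends i∈ h∉L
          tight-h : Tight j own₂ i h
          tight-h X i∈X c∉X q with ∈? X h
          ... | inj₁ p = p
          ... | inj₂ h∉X = contradiction (≤-trans (≤-trans (s≤s (cut (L⊆T i∈) X i∈X c∉X)) gain) q) (<-irrefl refl)
            where
            gain : suc (size (owned own i) X) ≤ size (owned own₂ i) X
            gain = cnt-insert (owned own i ∩ ∂ X) (owned own₂ i ∩ ∂ X) e
              (λ p → ∧-intro (grows i∈ (proj₁ (∧-elim p))) (proj₂ (∧-elim p)))
              (∧-intro (is-≡ own₂e) (∂-Ends X ends i∈X h∉X))
              (∧-falseˡ _ (is-≢ (λ { refl → ∈∉ i∈ free-L })))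
        place : ∀ i → ∃ λ p → i ∈ L → Token i p
        place i with ∈? L i
        ... | inj₁ i∈ = proj₁ (token i i∈) , λ _ → proj₂ (token i i∈)
        ... | inj₂ i∉ = c , λ i∈ → ∈∉ i∈ i∉
        advanced : ∃ λ W → ∃ λ own′ → W ⊆ L × cnt L ≤ 2 * cnt W × State (suc j) W own′
        advanced = Advance.advance st₂ Hub (λ {e} p → proj₁ (hub-parts {e} p)) (λ {e} → hub-avoids {e}) (proj₁ ∘ place)
              (λ {i} i∈ → proj₁ (proj₂ (place i) i∈)) (λ {i} i∈ → proj₁ (proj₂ (proj₂ (place i) i∈)))
              (λ {i} i∈ → proj₂ (proj₂ (proj₂ (place i) i∈)))

  -- One round is `prune`, `saturate`, `raise`. The last returns a state without `Rooted`, which is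
  -- why every round begins with pruning.
  raise-by : ∀ r {j T own} → 1 ≤ j → State j T own →
             (∀ {v} → v ∈ T → ∀ X → v ∈ X → c ∉ X → r + j ≤ cnt (∂ X)) →
             ∃ λ W → ∃ λ own′ → W ⊆ T × cnt T ≤ 6 ^ r * cnt W × State (r + j) W own′
  raise-by zero {T = T} {own} 1≤j st con = T , own , id , ≤-reflexive (sym (+-identityʳ (cnt T))) , st
  raise-by (suc r) {j} {T} {own} 1≤j st con =
    let con₁ : ∀ {v} → v ∈ T → ∀ X → v ∈ X → c ∉ X → suc j ≤ cnt (∂ X)
        con₁ = λ v∈ X p q → ≤-trans (s≤s (m≤n+m j r)) (con v∈ X p q)
        own₁ , st₁ , rooted = prune 1≤j st
        own₂ , st₂ , contact = saturate 1≤j con₁ st₁ rooted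
        W , own₃ , W⊆T , T≤6W , st₃ = raise 1≤j con₁ st₂ contact
        W′ , own₄ , W′⊆W , W≤ , st₄ = raise-by r (s≤s z≤n) st₃
          (λ v∈ X p q → ≤-trans (≤-reflexive (+-suc r j)) (con (W⊆T v∈) X p q))
    in W′ , own₄ , (λ p → W⊆T (W′⊆W p)) ,
       ≤-trans T≤6W (≤-trans (*-monoʳ-≤ 6 W≤) (≤-reflexive (sym (*-assoc 6 (6 ^ r) (cnt W′))))) ,
       subst (λ k → State k W′ own₄) (+-suc r j) st₄

-- Passing to `Subset`, and counting by fibres

private variable
  N : ℕ

∈-tabulate : (A : BSet N) {x : Fin N} → x ∈ A → x Subset.∈ tabulate A
∈-tabulate A {x} p = lookup⇒[]= x (tabulate A) (trans (lookup∘tabulate A x) p)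

tabulate-∈ : (A : BSet N) {x : Fin N} → x Subset.∈ tabulate A → x ∈ A
tabulate-∈ A {x} p = trans (sym (lookup∘tabulate A x)) ([]=⇒lookup p)

∣tabulate∣ : (A : BSet N) → Subset.∣ tabulate A ∣ ≡ cnt A
∣tabulate∣ {zero}  A = refl
∣tabulate∣ {suc N} A with A zero
... | true  = cong suc (∣tabulate∣ (A ∘ suc))
... | false = ∣tabulate∣ (A ∘ suc)

-- Double counting of the pairs formed by a point and its image.
fibres : ∀ {M} (f : Fin M → Fin N) (T : BSet N) (k : ℕ) → (∀ e → f e ∈ T) →
         (∀ v → v ∈ T → cnt (λ e → is (f e) v) ≤ k) → M ≤ k * cnt T
fibres {N} {M} f T k f∈T small = begin
  M                                       ≡⟨ sym (cnt-full {M}) ⟩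
  cnt {M} (λ _ → true)                    ≡⟨ sum-cong-≗ (λ e → sym (cnt-⁅⁆ (f e))) ⟩
  sum (λ e → sum (λ v → ⟦ is (f e) v ⟧))  ≡⟨ ∑-comm (λ e v → ⟦ is (f e) v ⟧) ⟩
  sum (λ v → cnt (λ e → is (f e) v))      ≤⟨ sum-mono fibre ⟩
  sum (λ v → k * ⟦ T v ⟧)                 ≡⟨ sym (*-distribˡ-sum k (λ v → ⟦ T v ⟧)) ⟩
  k * cnt T                               ∎
  where
  open ≤-Reasoning
  fibre : ∀ v → cnt (λ e → is (f e) v) ≤ k * ⟦ T v ⟧
  fibre v with ∈? T v
  ... | inj₁ v∈ rewrite v∈ | *-identityʳ k = small v v∈
  ... | inj₂ v∉ = ≤-trans (≤-reflexive (trans (cnt-cong (λ e → is (f e) v) ∅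
                    (λ e → is-≢ (λ { refl → ∈∉ (f∈T e) v∉ }))) (cnt-∅ {M}))) z≤n

-- From a state at level `suc k` to a strong immersion of the star

module Realise (G : Graph) (c : Graph.Vertex G) {k : ℕ} {W : BSet (Graph.#V G)} where
  open Graph G using (source; target; Joins)
  open Cuts source target
  open Levels source target c
  open Menger source target c

  -- Menger's theorem splits the edges of each chosen terminal into `suc k` classes that join it to
  -- `c`; an edge of the star is sent into the class named by its `ray` and `strand`.
  realise : ∀ {n own} → State (suc k) W own → n ≤ cnt W →
    Σ[ θ ∈ StrongImmersion (starGraph n (suc k)) G ]
      (StrongImmersion.onV θ zero ≡ c × ∀ i → StrongImmersion.onV θ (suc i) ∈ W)
  realise {n} {own} st n≤ = record
    { immersion = record
      { onV = onV ; onE = onE ; injective = onV-inj ; connected = λ e → connected e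
      ; disjoint = disjoint ; incident = incident ; loop = λ _ () }
    ; strong = λ {e} {v} → strong {e} {v} } , refl , f∈
    where
    open State st
    f : Fin n → Fin _
    f = proj₁ (pick W n≤)
    f-inj : Injective _≡_ _≡_ f
    f-inj = proj₁ (proj₂ (pick W n≤))
    f∈ : ∀ i → f i ∈ W
    f∈ = proj₂ (proj₂ (pick W n≤))
    c≢f : ∀ i → c ≢ f i
    c≢f i eq = ∈∉ (f∈ i) (trans (cong W (sym eq)) c∉T)

    links : ∀ i → Σ[ lab ∈ _ ] (∀ t → Conn (λ x → owned own (f i) x ∧ is (lab x) t) (f i) c)
    links i = edge-disjoint-links (owned own (f i)) (f i) (cut (f∈ i))
    lab : ∀ i → Fin (Graph.#E G) → Fin (suc k)
    lab i = proj₁ (links i)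

    ray : Fin (n * suc k) → Fin n
    ray e = quotient (suc k) e
    strand : Fin (n * suc k) → Fin (suc k)
    strand e = remainder {n} (suc k) e
    Class : Fin (n * suc k) → BSet (Graph.#E G)
    Class e x = owned own (f (ray e)) x ∧ is (lab (ray e) x) (strand e)
    module C e = Component (component (Class e) c)

    onV : Fin (suc n) → Fin (Graph.#V G)
    onV zero    = c
    onV (suc i) = f i

    onV-inj : Injective _≡_ _≡_ onV
    onV-inj {zero}  {zero}  eq = refl
    onV-inj {zero}  {suc j} eq = contradiction eq (c≢f j)
    onV-inj {suc i} {zero}  eq = contradiction (sym eq) (c≢f i)
    onV-inj {suc i} {suc j} eq = cong suc (f-inj eq)

    -- The whole component of `c` in the class serves as the image: an immersion asks for a
    -- connected subgraph, not for a path.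
    onE : Fin (n * suc k) → Subgraph G
    onE e = record
      { verts = tabulate (C.K e) ; edges = tabulate (C.Inside e)
      ; closed = λ {x} p → let q , s∈ = ∩-elim (Class e) (C.K e ∘ source) (tabulate-∈ (C.Inside e) p) in
          ∈-tabulate (C.K e) s∈ , ∈-tabulate (C.K e) (C.closed e q (inj₁ (refl , refl)) s∈) }

    Adj : Fin (n * suc k) → Fin _ → Fin _ → Set
    Adj e = Adjacent (onE e)

    connected : ∀ e → Connected (onE e)
    connected e u∈ v∈ = reverse (λ (x , p , j) → x , p , Ends-sym j) (from-c u∈) ◅◅ from-c v∈
      where
      convert : ∀ {u v} → Star (Step (C.Inside e)) u v → Star (Adj e) u v
      convert ε = ε
      convert ((x , p , j) ◅ s) = (x , ∈-tabulate (C.Inside e) p , j) ◅ convert s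
      from-c : ∀ {v} → v Subset.∈ tabulate (C.K e) → Star (Adj e) c v
      from-c v∈ = convert (C.walk-inside e (tabulate-∈ (C.K e) v∈))

    class-of : ∀ e {x} → x ∈ C.Inside e → own x ≡ f (ray e) × lab (ray e) x ≡ strand e
    class-of e p with ∩-elim (Class e) (C.K e ∘ source) p
    ... | q , _ with ∧-elim q
    ... | r , s = is-true r , is-true s

    disjoint : ∀ {e e′} → e ≢ e′ → EdgeDisjoint (onE e) (onE e′)
    disjoint {e} {e′} e≢e′ {x} p q
      with class-of e (tabulate-∈ (C.Inside e) p) | class-of e′ (tabulate-∈ (C.Inside e′) q)
    ... | o , l | o′ , l′ = e≢e′ (begin
      e                             ≡⟨ sym (combine-remQuot {n} (suc k) e) ⟩
      combine (ray e) (strand e)    ≡⟨ cong₂ combine ray≡ (trans (sym l) (trans (cong (λ i → lab i x) ray≡) l′)) ⟩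
      combine (ray e′) (strand e′)  ≡⟨ combine-remQuot {n} (suc k) e′ ⟩
      e′                                 ∎)
      where
      open ≡-Reasoning
      ray≡ : ray e ≡ ray e′
      ray≡ = f-inj (trans (sym o) o′)

    incident : ∀ {e v} → Graph.Incident (starGraph n (suc k)) e v → onV v Subset.∈ tabulate (C.K e)
    incident {e} (inj₁ refl) = ∈-tabulate (C.K e) (C.c∈ e)
    incident {e} (inj₂ refl) = ∈-tabulate (C.K e) (C.Conn⇒∈ e (proj₂ (links (ray e)) (strand e)))

    strong : ∀ {e v} → ¬ Graph.Incident (starGraph n (suc k)) e v → onV v Subset.∉ tabulate (C.K e)
    strong {e} {zero}  ¬inc _ = ¬inc (inj₁ refl)
    -- A terminal `f i` in the component would be an end of one of its edges; `private-ends` then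
    -- makes `f i` the owner of that edge, so it is the ray of `e`.
    strong {e} {suc i} ¬inc p with C.∈⇒Conn e (tabulate-∈ (C.K e) p) ⁅ f i ⁆ (is-refl (f i)) (is-≢ (c≢f i ∘ sym))
    ... | x , x∈ , cr with ∂⇒Ends ⁅ f i ⁆ cr | class-of e x∈
    ... | u , z , j , u∈ , _ | own≡ , _ = ¬inc (inj₂ (cong suc (f-inj (sym (trans
            (private-ends (subst (_∈ W) (sym own≡) (f∈ (ray e))) (f∈ i) (subst (Inc x) (sym (is-true u∈)) (Ends⇒Incˡ j)))
            own≡)))))

-- Passing from edges to rays costs a factor `k`, and each of the `k ∸ 1` rounds a factor 6, which
-- is at most `2 * k + 1` since `k` is at least 3.
6^≤d : ∀ k → 3 ≤ k → k * 6 ^ (k ∸ 1) ≤ d k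
6^≤d k 3≤k = begin
  k * 6 ^ (k ∸ 1)                                ≤⟨ *-mono-≤ k≤ (≤-trans (^-monoʳ-≤ 6 exponent) (^-monoˡ-≤ (8 * k + 4) base)) ⟩
  (k ^ 2 * (k + 1)) * (2 * k + 1) ^ (8 * k + 4)  ≡⟨ *-comm (k ^ 2 * (k + 1)) _ ⟩
  (2 * k + 1) ^ (8 * k + 4) * (k ^ 2 * (k + 1))  ≡⟨ sym (*-assoc ((2 * k + 1) ^ (8 * k + 4)) (k ^ 2) (k + 1)) ⟩
  (2 * k + 1) ^ (8 * k + 4) * k ^ 2 * (k + 1)    ∎
  where
  open ≤-Reasoning
  base : 6 ≤ 2 * k + 1
  base = ≤-trans (*-monoʳ-≤ 2 3≤k) (m≤m+n _ 1)
  exponent : k ∸ 1 ≤ 8 * k + 4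
  exponent = ≤-trans (m∸n≤m k 1) (≤-trans (m≤m+n k (7 * k)) (m≤m+n (8 * k) 4))
  instance
    k≢0 : NonZero k
    k≢0 = >-nonZero (≤-trans (s≤s z≤n) 3≤k)
  k≤ : k ≤ k ^ 2 * (k + 1)
  k≤ = ≤-trans (≤-trans (m≤m*n k k) (≤-reflexive (cong (k *_) (sym (*-identityʳ k)))))
         (m≤m*n (k ^ 2) (k + 1) ⦃ >-nonZero (m≤n+m 1 k) ⦄)

-- The state at level one given by a `k`-system

module Base {k m : ℕ} {G : Graph} (sys : KSystem k m G) where
  open Graph G using (source; target; #V)
  open KSystem sys using (H; σ; ray-degree; no-edge-cut; magnitude) renaming
    (graph to HG; center to h₀; loopless to H-loopless; all-center to H-all-center; connected to H-connected)
  open StrongImmersion σ using (onV; onE; injective; disjoint; incident; strong) renaming (connected to σ-connected)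
  module HG = Graph HG

  c : Fin #V
  c = onV h₀

  open Cuts source target
  open Levels source target c

  T : BSet #V
  T v = does (any? (λ r → ¬? (r ≟ h₀) ×-dec (onV r ≟ v)))

  T-intro : ∀ {r} → r ≢ h₀ → onV r ∈ T
  T-intro {r} r≢ = dec-true (any? _) (r , r≢ , refl)

  T-elim : ∀ {v} → v ∈ T → ∃ λ r → r ≢ h₀ × onV r ≡ v
  T-elim {v} p with any? (λ r → ¬? (r ≟ h₀) ×-dec (onV r ≟ v))
  ... | yes q = q

  c∉T : c ∉ T
  c∉T with ∈? T c
  ... | inj₂ p = p
  ... | inj₁ p with T-elim p
  ... | r , r≢ , eq = contradiction (injective eq) r≢

  ray : HG.Edge → HG.Vertex
  ray e with HG.source e ≟ h₀
  ... | yes _ = HG.target e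
  ... | no  _ = HG.source e

  ray-spec : ∀ e → ray e ≢ h₀ × HG.Incident e (ray e) × (∀ {v} → HG.Incident e v → v ≢ h₀ → v ≡ ray e)
  ray-spec e with HG.source e ≟ h₀
  ... | yes p = (λ q → H-loopless e (trans p (sym q))) , inj₂ refl ,
                λ { (inj₁ q) v≢ → contradiction (trans (sym q) p) v≢ ; (inj₂ q) _ → sym q }
  ... | no ¬p with H-all-center e
  ... | inj₁ q = contradiction q ¬p
  ... | inj₂ q = ¬p , inj₁ refl ,
                λ { (inj₁ r) _ → sym r ; (inj₂ r) v≢ → contradiction (trans (sym r) q) v≢ }

  owner? : ∀ x → Dec (∃ λ e → x Subset.∈ Subgraph.edges (onE e))
  owner? x = any? (λ e → x ∈ˢ? Subgraph.edges (onE e))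

  own : Ownership
  own x with owner? x
  ... | yes (e , _) = onV (ray e)
  ... | no _        = c

  -- The images of the edges of `H` are edge-disjoint, so the search in `owner?` can only find `e`.
  own-≡ : ∀ {e x} → x Subset.∈ Subgraph.edges (onE e) → own x ≡ onV (ray e)
  own-≡ {e} {x} p with owner? x
  ... | no ¬q = contradiction (e , p) ¬q
  ... | yes (e′ , q) with e′ ≟ e
  ... | yes refl = refl
  ... | no e′≢e = contradiction p (disjoint e′≢e q)

  own-elim : ∀ {x} → own x ∈ T → ∃ λ e → x Subset.∈ Subgraph.edges (onE e) × own x ≡ onV (ray e)
  own-elim {x} p with owner? x
  ... | yes (e , q) = e , q , refl
  ... | no _ = ∈∉ p c∉T

  spoke : ∀ r → r ≢ h₀ → ∃ λ e → HG.Incident e r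
  spoke r r≢ with H-connected {r} {h₀} ∈⊤ ∈⊤
  ... | ε = contradiction refl r≢
  ... | (e , _ , inj₁ (p , _)) ◅ _ = e , inj₁ p
  ... | (e , _ , inj₂ (_ , p)) ◅ _ = e , inj₂ p

  -- Every ray is an end of some edge of `H`, whose image joins it to `c`; this yields one edge in
  -- each cut. `private-ends` is where the strength of `σ` enters.
  state : State 1 T own
  state = record { c∉T = c∉T ; cut = cut ; private-ends = private-ends }
    where
    linked : ∀ {v} → v ∈ T → Conn (owned own v) v c
    linked {v} v∈ with T-elim v∈
    ... | r , r≢ , refl with spoke r r≢
    ... | e , inc = Step⇒Conn (convert (σ-connected e (incident inc) (incident (H-all-center e))))
      where
      convert : ∀ {a b} → Star (Adjacent (onE e)) a b → Star (Step (owned own (onV r))) a b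
      convert ε = ε
      convert ((x , p , j) ◅ s) =
        (x , is-≡ (trans (own-≡ p) (cong onV (sym (proj₂ (proj₂ (ray-spec e)) inc r≢)))) , j) ◅ convert s
    cut : ∀ {v} → v ∈ T → ∀ X → v ∈ X → c ∉ X → 1 ≤ size (owned own v) X
    cut {v} v∈ X p q with linked v∈ X p q
    ... | x , x∈ , cr = ≤-trans (s≤s z≤n) (cnt-insert ∅ (owned own v ∩ ∂ X) x (λ ()) (∧-intro x∈ cr) refl)
    private-ends : ∀ {x w} → own x ∈ T → w ∈ T → Inc x w → w ≡ own x
    private-ends {x} {w} p w∈ inc with own-elim p | T-elim w∈
    ... | e , x∈ , eq | r , r≢ , refl with r ≟ ray e
    ... | yes r≡ = trans (cong onV r≡) (sym eq)
    ... | no r≢ray = contradiction (end inc) (strong (λ i → r≢ray (proj₂ (proj₂ (ray-spec e)) i r≢)))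
      where
      end : Inc x (onV r) → onV r Subset.∈ Subgraph.verts (onE e)
      end (inj₁ q) = subst (Subset._∈ _) q (proj₁ (Subgraph.closed (onE e) x∈))
      end (inj₂ q) = subst (Subset._∈ _) q (proj₂ (Subgraph.closed (onE e) x∈))

  connectivity : ∀ {v} → v ∈ T → ∀ X → v ∈ X → c ∉ X → k ≤ cnt (∂ X)
  connectivity {v} v∈ X p q with T-elim v∈
  ... | r , r≢ , refl = ≮⇒≥ (λ lt → no-edge-cut r r≢
        -- An `EdgeCutOfSizeBelow` here has the centre on its inner side, whereas `X` contains the
        -- terminal; hence the complement.
        (tabulate (∁ X) , ∈-tabulate (∁ X) (not-intro q) ,
         (λ s → ∈∉ p (not-true (tabulate-∈ (∁ X) s))) , subst (_< k) (sym size-δ) lt))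
    where
    size-δ : Subset.∣ Graph.δ G (tabulate (∁ X)) ∣ ≡ cnt (∂ X)
    size-δ = trans (∣tabulate∣ (∂ (lookup (tabulate (∁ X)))))
      (trans (cnt-cong (∂ (lookup (tabulate (∁ X)))) (∂ (∁ X)) (∂-cong (lookup∘tabulate (∁ X))))
             (size-∁ (λ _ → true) X))

  many-rays : m ≤ k * cnt T
  many-rays = ≤-trans magnitude (fibres (onV ∘ ray) T k (λ e → T-intro (proj₁ (ray-spec e))) small)
    where
    small : ∀ v → v ∈ T → cnt (λ e → is (onV (ray e)) v) ≤ k
    small v v∈ with T-elim v∈
    ... | r , r≢ , refl = begin
      cnt (λ e → is (onV (ray e)) (onV r))  ≤⟨ cnt-mono (λ e → is (onV (ray e)) (onV r)) (A ∪ B) sub ⟩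
      cnt (A ∪ B)                           ≤⟨ cnt-∪ A B ⟩
      cnt A + cnt B                         ≡⟨ sym (cong₂ _+_ (∣tabulate∣ A) (∣tabulate∣ B)) ⟩
      HG.degree r                           ≤⟨ ray-degree r r≢ ⟩
      k                                     ∎
      where
      open ≤-Reasoning
      A B : BSet HG.#E
      A e = does (HG.source e ≟ r)
      B e = does (HG.target e ≟ r)
      sub : (λ e → is (onV (ray e)) (onV r)) ⊆ A ∪ B
      sub {e} p with injective (is-true p) | proj₁ (proj₂ (ray-spec e))
      ... | eq | inj₁ q = ∨-introˡ (dec-true (HG.source e ≟ r) (trans q eq))
      ... | eq | inj₂ q = ∨-introʳ (A e) (dec-true (HG.target e ≟ r) (trans q eq))

-- From the `k`-system through all levels to the immersion

theorem2 : ∀ (k n : ℕ) (3≤k : 3 ≤ k) (2≤n : 2 ≤ n)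
    (G : Graph) (m : ℕ) → d k * n ≤ m → (sys : KSystem k m G) →
    let Snk = S n k 2≤n (≤-trans (s≤s z≤n) 3≤k) in
    Σ[ θ ∈ StrongImmersion (Multistar.graph Snk) G ] Respects Snk θ sys
theorem2 (suc k) n 3≤k 2≤n G m large sys =
  -- The degree is `suc k` here, so `k` rounds lead from level 1 to the level required.
  let W , own′ , W⊆T , T≤ , st = raise-by k ≤-refl state
        (λ v∈ X p q → ≤-trans (≤-reflexive (+-comm k 1)) (connectivity v∈ X p q))
      θ , centre , rays = realise (subst (λ j → State j W own′) (+-comm k 1) st) (n≤ T≤)
  in θ , record
    { center↦center = centre
    ; rays⊆rays = λ { zero r≢ → contradiction refl r≢
                    ; (suc i) _ → let s , s≢ , eq = T-elim (W⊆T (rays i)) in s , s≢ , sym eq } }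
  where
  open Base sys
  open Growth (Graph.source G) (Graph.target G) c
  open Levels (Graph.source G) (Graph.target G) c using (State)
  open Realise G c
  n≤ : ∀ {w} → cnt T ≤ 6 ^ k * w → n ≤ w
  n≤ {w} T≤ = *-cancelˡ-≤ (suc k * 6 ^ k) ⦃ m*n≢0 (suc k) (6 ^ k) ⦃ _ ⦄ ⦃ m^n≢0 6 k ⦄ ⦄ (begin
    suc k * 6 ^ k * n    ≤⟨ *-monoˡ-≤ n (6^≤d (suc k) 3≤k) ⟩
    d (suc k) * n        ≤⟨ large ⟩
    m                    ≤⟨ many-rays ⟩
    suc k * cnt T        ≤⟨ *-monoʳ-≤ (suc k) T≤ ⟩
    suc k * (6 ^ k * w)  ≡⟨ sym (*-assoc (suc k) (6 ^ k) w) ⟩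
    suc k * 6 ^ k * w          ∎)
    where open ≤-Reasoning
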